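{- For a positive integer $n$, let $A(n)$ denote the number of partitions of $n$ into distinct parts with no $1$'s and a gap of at least $2$ between consecutive parts, and let $B(n)$ denote the number of partitions of $n$ into parts $\equiv 2,3 \pmod 5$. Let $C(n)$ denote the number of partitions of $n$ into distinct parts with no $1$'s appearing, such that if $o_j$ is the $j$-th odd part (where the odd parts are ordered in ascending order), then the even parts $o_j+2j-3$ and $o_j+2j-1$ do not appear. Let $D(n)$ denote the number of partitions of $n$ into distinct parts with no $1$'s appearing, such that if $e_j$ is the $j$-th even part (where the even parts are ordered in ascending order), then the odd parts $e_j+2j-1$ and $e_j+2j+1$ do not appear. Then $A(n)=B(n)=C(n)=D(n)$ for every positive integer $n$.
   Context: The condition in $C(n)$ is imposed for every $j$ from $1$ to the number of odd parts, with $o_1<o_2<\cdots$ all the odd parts of the partition; the condition in $D(n)$ is imposed for every $j$ from $1$ to the number of even parts, with $e_1<e_2<\cdots$ all the even parts. "Gap of at least $2$ between consecutive parts" means consecutive parts (in size order) differ by at least $2$. -}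

module Defs where

open import Data.Fin.Base using (Fin; toℕ)
open import Data.Fin.Properties using (all?)
open import Data.List.Base
  using (List; []; _∷_; [_]; map; concatMap; filter; length; lookup; upTo)
open import Data.List.Membership.DecPropositional using (_∉?_)
open import Data.List.Membership.Propositional using (_∈_; _∉_; find; lose)
open import Data.List.Membership.Propositional.Properties
  using (∈-map⁺; ∈-map⁻; ∈-concatMap⁺; ∈-concatMap⁻; ∈-upTo⁺; ∈-upTo⁻)
open import Data.List.Properties using (∷-injectiveˡ; ∷-injectiveʳ)
open import Data.List.Relation.Unary.All as All using (All; []; _∷_)
import Data.List.Relation.Unary.All.Properties as All
open import Data.List.Relation.Unary.AllPairs as AllPairs using ()
import Data.List.Relation.Unary.AllPairs.Properties as AllPairs
open import Data.List.Relation.Unary.Any using (here)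
open import Data.List.Relation.Unary.Linked as Linked using (Linked; []; [-]; _∷_)
open import Data.List.Relation.Unary.Sorted.TotalOrder using (Sorted)
open import Data.List.Relation.Unary.Unique.DecPropositional using (unique?)
open import Data.List.Relation.Unary.Unique.Propositional using (Unique; []; _∷_)
import Data.List.Relation.Unary.Unique.Propositional.Properties as Unique
open import Data.Nat.Base
open import Data.Nat.Divisibility using (_∣?_)
open import Data.Nat.DivMod using (_%_)
open import Data.Nat.ListAction using (sum)
open import Data.Nat.Properties
open import Data.Product.Base using (_×_; _,_; proj₁; proj₂)
open import Data.Sum.Base using (_⊎_)
open import Function.Base using (_∘_)
open import Function.Bundles using (_⇔_; mk⇔)
open import Relation.Binary.PropositionalEquality
  using (_≡_; _≢_; refl; sym; trans; cong; subst)
open import Relation.Nullary.Decidable using (¬?; _×-dec_; _⊎-dec_)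
open import Relation.Unary using (Pred; Decidable)
open import Level using (0ℓ)

-- A partition is represented by the list of its parts in ascending order.

record _IsPartitionOf_ (ps : List ℕ) (n : ℕ) : Set where
  constructor mkPartition
  field
    positive  : All (1 ≤_) ps
    ascending : Sorted ≤-totalOrder ps
    total     : sum ps ≡ n

-- The partitions of n with all parts at least m, for m ≥ 1; the first
-- argument only bounds the recursion and has to be at least n.

partitionsFrom : ℕ → ℕ → ℕ → List (List ℕ)
partitionsFrom _       _ zero      = [ [] ]
partitionsFrom zero    _ (suc _)   = []
partitionsFrom (suc b) m n@(suc _) =
  concatMap (λ p → map (p ∷_) (partitionsFrom b p (n ∸ p)))
            (map (m +_) (upTo (suc n ∸ m)))

partitions : ℕ → List (List ℕ)
partitions n = partitionsFrom n 1 n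

-- `partitions n` lists every partition of n exactly once (`∈-partitions⇔`
-- and `partitions-unique` below), so this is a number of partitions.

count : {P : Pred (List ℕ) 0ℓ} → Decidable P → ℕ → ℕ
count P? n = length (filter P? (partitions n))

Distinct NoOnes Gap≥2 Parts≡2,3[mod5] : Pred (List ℕ) 0ℓ
Distinct         = Unique
NoOnes        ps = 1 ∉ ps
Gap≥2            = Linked (λ p q → 2 ≤ ∣ p - q ∣)
Parts≡2,3[mod5]  = All (λ p → p % 5 ≡ 2 ⊎ p % 5 ≡ 3)

oddParts evenParts : List ℕ → List ℕ
oddParts  = filter (¬? ∘ (2 ∣?_))
evenParts = filter (2 ∣?_)

-- `lookup` is 0-based, hence j = suc (toℕ i).  No subtraction is truncated,
-- since j ≥ 1 and odd numbers are at least 1.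

OddCondition EvenCondition : Pred (List ℕ) 0ℓ
OddCondition ps = (i : Fin (length (oddParts ps))) →
  let o = lookup (oddParts ps) i
      j = suc (toℕ i)
  in (o + 2 * j ∸ 3) ∉ ps × (o + 2 * j ∸ 1) ∉ ps
EvenCondition ps = (i : Fin (length (evenParts ps))) →
  let e = lookup (evenParts ps) i
      j = suc (toℕ i)
  in (e + 2 * j ∸ 1) ∉ ps × (e + 2 * j + 1) ∉ ps

distinct? : Decidable Distinct
distinct? = unique? _≟_

noOnes? : Decidable NoOnes
noOnes? ps = _∉?_ _≟_ 1 ps

gap≥2? : Decidable Gap≥2
gap≥2? = Linked.linked? (λ p q → 2 ≤? ∣ p - q ∣)

parts≡2,3[mod5]? : Decidable Parts≡2,3[mod5]
parts≡2,3[mod5]? = All.all? (λ p → (p % 5 ≟ 2) ⊎-dec (p % 5 ≟ 3))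

oddCondition? : Decidable OddCondition
oddCondition? ps = all? λ _ → _∉?_ _≟_ _ ps ×-dec _∉?_ _≟_ _ ps

evenCondition? : Decidable EvenCondition
evenCondition? ps = all? λ _ → _∉?_ _≟_ _ ps ×-dec _∉?_ _≟_ _ ps

A B C D : ℕ → ℕ
A = count (λ ps → distinct? ps ×-dec noOnes? ps ×-dec gap≥2? ps)
B = count parts≡2,3[mod5]?
C = count (λ ps → distinct? ps ×-dec noOnes? ps ×-dec oddCondition? ps)
D = count (λ ps → distinct? ps ×-dec noOnes? ps ×-dec evenCondition? ps)

private

  sound : ∀ b m n {ps} → ps ∈ partitionsFrom b m n →
          Linked _≤_ (m ∷ ps) × sum ps ≡ n
  sound zero    m zero (here refl) = [-] , refl
  sound (suc b) m zero (here refl) = [-] , refl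
  sound (suc b) m n@(suc _) ps∈
    with p , p∈ , ps∈′ ← find (∈-concatMap⁻
           (λ p → map (p ∷_) (partitionsFrom b p (n ∸ p)))
           {xs = map (m +_) (upTo (suc n ∸ m))} ps∈)
    with i , i∈ , refl ← ∈-map⁻ (m +_) p∈
    with qs , qs∈ , refl ← ∈-map⁻ (p ∷_) ps∈′
    with asc , tot ← sound b p (n ∸ p) qs∈
    = m≤m+n m i ∷ asc , trans (cong (p +_) tot) (m+[n∸m]≡n (p≤n i∈))
    where
    p≤n : ∀ {i} → i ∈ upTo (suc n ∸ m) → m + i ≤ n
    p≤n {i} i∈ = s≤s⁻¹ (subst (_< suc n) (+-comm i m)
      (m≤o∸n⇒m+n≤o (suc i) m≤1+n i<))
      where
      i< : i < suc n ∸ m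
      i< = ∈-upTo⁻ i∈
      m≤1+n : m ≤ suc n
      m≤1+n = <⇒≤ (m∸n≢0⇒n<m λ eq → n≮0 (subst (i <_) eq i<))

  complete : ∀ b m n {ps} → 1 ≤ m → n ≤ b →
             Linked _≤_ (m ∷ ps) → sum ps ≡ n → ps ∈ partitionsFrom b m n
  complete zero    m zero {[]} _ _ _ _ = here refl
  complete (suc b) m zero {[]} _ _ _ _ = here refl
  complete b m zero {p ∷ ps} 1≤m _ (m≤p ∷ _) eq
    with () ← subst (1 ≤_) eq (≤-trans 1≤m (≤-trans m≤p (m≤m+n p (sum ps))))
  complete (suc b) m n@(suc n′) {p ∷ ps} 1≤m n≤b (m≤p ∷ asc) eq =
    ∈-concatMap⁺
      (λ p → map (p ∷_) (partitionsFrom b p (n ∸ p)))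
      (lose p∈ (∈-map⁺ (p ∷_)
      (complete b p (n ∸ p) 1≤p n∸p≤b asc
        (trans (sym (m+n∸m≡n p (sum ps))) (cong (_∸ p) eq)))))
    where
    1≤p : 1 ≤ p
    1≤p = ≤-trans 1≤m m≤p
    n∸p≤b : n ∸ p ≤ b
    n∸p≤b = ≤-trans (∸-monoʳ-≤ n 1≤p) (s≤s⁻¹ n≤b)
    p≤n : p ≤ n
    p≤n = subst (p ≤_) eq (m≤m+n p (sum ps))
    p∈ : p ∈ map (m +_) (upTo (suc n ∸ m))
    p∈ = subst (_∈ map (m +_) (upTo (suc n ∸ m))) (m+[n∸m]≡n m≤p)
           (∈-map⁺ (m +_) (∈-upTo⁺ (∸-monoˡ-< (s≤s p≤n) m≤p)))

  unique : ∀ b m n → Unique (partitionsFrom b m n)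
  unique zero    m zero    = [] ∷ []
  unique (suc b) m zero    = [] ∷ []
  unique zero    m (suc n) = []
  unique (suc b) m n@(suc _) = Unique.concat⁺
    (All.map⁺ (All.universal
      (λ p → Unique.map⁺ ∷-injectiveʳ (unique b p (n ∸ p))) _))
    (AllPairs.map⁺ (AllPairs.map disjoint
      (Unique.map⁺ (+-cancelˡ-≡ m _ _) (Unique.upTo⁺ (suc n ∸ m)))))
    where
    disjoint : ∀ {p q xss yss} → p ≢ q → ∀ {zs} →
               zs ∈ map (p ∷_) xss × zs ∈ map (q ∷_) yss → _
    disjoint p≢q (zs∈₁ , zs∈₂)
      with _ , _ , refl ← ∈-map⁻ _ zs∈₁
      with _ , _ , eq ← ∈-map⁻ _ zs∈₂
      = p≢q (∷-injectiveˡ eq)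

  bounded : ∀ {m ps} → 1 ≤ m → Linked _≤_ (m ∷ ps) → All (1 ≤_) ps
  bounded 1≤m [-]         = []
  bounded 1≤m (m≤p ∷ asc) = ≤-trans 1≤m m≤p ∷ bounded (≤-trans 1≤m m≤p) asc

  cons : ∀ {ps} → All (1 ≤_) ps → Linked _≤_ ps → Linked _≤_ (1 ∷ ps)
  cons []        []  = [-]
  cons (1≤p ∷ _) asc = 1≤p ∷ asc

∈-partitions⇔ : ∀ {n ps} → ps ∈ partitions n ⇔ ps IsPartitionOf n
∈-partitions⇔ {n} = mk⇔
  (λ ps∈ → let asc , tot = sound n 1 n ps∈ in
     mkPartition (bounded ≤-refl asc) (Linked.tail asc) tot)
  (λ (mkPartition pos asc tot) → complete n 1 n ≤-refl ≤-refl (cons pos asc) tot)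

partitions-unique : ∀ n → Unique (partitions n)
partitions-unique n = unique n 1 n

{-# OPTIONS --safe #-}

-- All generating functions live in power series truncated at qᴺ, where q is
-- nilpotent, so that every sum and product below is finite and every 1 − qr
-- is cancellable.
--
-- A = B is Rogers' proof of the second Rogers–Ramanujan identity: the series
-- α(m) of the partitions with gaps ≥ 2 and parts ≥ m satisfies
-- α(m) = α(m+1) + qᵐ α(m+2), and so do the alternating series S₂ divided by
-- (q)∞; at m = 2 the latter is a theta series, which the triple product turns
-- into a product.
--
-- For A = C and A = D, halve all parts.  In C let R be the halves of the odd
-- parts and S the halves of the even ones, in D the other way round.  Both
-- conditions then say that rⱼ + j − 1 and rⱼ + j are not in S.  Scanning
-- r = 1, 2, …, with d elements of R already seen, either r ∈ R, or r ∉ R and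
-- r + d may freely be put into S.  If s ∈ S has weight u q²ˢ, the resulting
-- series satisfies ω(r, d) = ω(r, d+1) + u q²⁽ʳ⁺ᵈ⁾ ω(r+1, d), and this extra
-- relation reduces ω(r, 0) = α(2r) to the recurrence of α.
module Submission where

open import Defs
open import Algebra.Bundles using (CommutativeRing)
open import Algebra.Solver.Ring.AlmostCommutativeRing
  using (_-Raw-AlmostCommutative⟶_; fromCommutativeRing; Induced-equivalence)
open import Data.Empty using (⊥; ⊥-elim)
open import Data.Fin.Base using (Fin; zero; suc; toℕ)
open import Data.Integer.Base as ℤ using (ℤ; +_; -[1+_])
import Data.Integer.Properties as ℤ
import Data.Integer.Tactic.RingSolver as ℤ-Solver
open import Data.List.Base using (List; []; _∷_; [_]; _++_; map; filter; length; lookup)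
open import Data.List.Membership.Propositional using (_∈_; _∉_)
open import Data.List.Membership.Propositional.Properties
  using (∈-map⁺; ∈-map⁻; ∈-++⁺ˡ; ∈-++⁺ʳ; ∈-++⁻; ∈-filter⁺; ∈-filter⁻)
open import Data.List.Membership.Propositional.Properties.WithK using (unique∧set⇒bag)
open import Data.List.Properties
  using (filter-accept; filter-reject; length-map; map-∘; map-id-local; ∷-injectiveʳ)
open import Data.List.Relation.Binary.BagAndSetEquality using (∼bag⇒↭)
open import Data.List.Relation.Binary.Permutation.Propositional using (_↭_; ↭-sym; ↭⇒↭ₛ)
open import Data.List.Relation.Binary.Permutation.Propositional.Properties
  using (↭-length; ∈-resp-↭)
import Data.List.Relation.Binary.Permutation.Setoid.Properties as Permutation
open import Data.List.Relation.Unary.All as All using (All; []; _∷_)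
import Data.List.Relation.Unary.All.Properties as All
open import Data.List.Relation.Unary.AllPairs as AllPairs using (AllPairs; []; _∷_)
import Data.List.Relation.Unary.AllPairs.Properties as AllPairs
open import Data.List.Relation.Unary.Any using (here; there)
open import Data.List.Relation.Unary.Linked as Linked using (Linked)
import Data.List.Relation.Unary.Linked.Properties as Linked
open import Data.List.Relation.Unary.Unique.Propositional using (Unique)
import Data.List.Relation.Unary.Unique.Propositional.Properties as Unique
open import Data.Maybe.Base using (just; nothing)
open import Data.Nat.Base as ℕ using (ℕ; zero; suc; _≤_; _<_; z≤n; s≤s; ∣_-_∣; ⌊_/2⌋)
open import Data.Nat.Divisibility using (_∣_; _∣?_; divides; divides-refl)
open import Data.Nat.DivMod using (_%_; _/_; m≡m%n+[m/n]*n; m/n≤m; [m+kn]%n≡m%n)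
open import Data.Nat.ListAction using (sum)
open import Data.Nat.ListAction.Properties using (sum-↭; sum-++)
import Data.Nat.Properties as ℕ
import Data.Nat.Tactic.RingSolver as ℕ-Solver
open import Data.List.Sort ℕ.≤-decTotalOrder using (sort; sort-↭; sort-↗)
open import Data.Product.Base using (_×_; _,_; proj₁; proj₂; ∃-syntax)
open import Data.Product.Properties using (×-≡,≡→≡)
open import Data.Sum.Base using (_⊎_; inj₁; inj₂; [_,_]′)
open import Data.Unit.Base using (⊤; tt)
open import Function.Base using (_∘_; id)
open import Function.Bundles using (mk⇔; Equivalence)
open import Level using (0ℓ)
open import Relation.Binary.Definitions using (WeaklyDecidable)
open import Relation.Binary.PropositionalEquality as ≡ using (_≡_; _≢_)
open import Relation.Nullary.Decidable using (yes; no; ¬?; _×-dec_; toSum)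
open import Relation.Nullary.Negation using (¬_)
open import Relation.Unary using (Pred; Decidable)

-- The truncated ring has no division, which shapes almost every identity: a quotient appears only
-- multiplied by its denominator, and a factor is removed only through `Cancellable`. Nilpotency
-- makes limits exact: Pochhammer products are constant from index N on, and a solution of the
-- recurrence of α is determined by its values at m ≥ N, so two solutions are compared by downward
-- induction from there. S₁ and S₂ need only finite products because Andrews' x is specialised to
-- qᵗ: the quotient of (q)∞ by (q)ₙ (qⁿ⁺ᵗ⁺¹)∞ is then `poch q n t`. Their recurrences and the finite
-- triple product are telescoped with explicit certificates, so that each comes down to a polynomial
-- identity. In the ladder, the defining recursion alone raises d without end. Equating it with the
-- extra relation at d = 0 cancels the term with u and leaves a closed system for d = 0 and d = 1.
-- At u = 1, v = q this is the recurrence of α itself; at u = q, v = 1 it is that recurrence with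
-- the odd arguments eliminated.

-- Ring solver with integer coefficients over an arbitrary commutative ring

module IntegerSolver {c ℓ} (R : CommutativeRing c ℓ) where
  open CommutativeRing R
  open import Algebra.Properties.Ring ring
  open import Algebra.Properties.AbelianGroup +-abelianGroup using (⁻¹-∙-comm; ε⁻¹≈ε; ⁻¹-involutive)
  -- In this version `1 · 1#` computes to `1#`, so `con (+ 1)` denotes `1#` definitionally and the
  -- solved equations match their goals.
  open import Algebra.Properties.Semiring.Mult.TCOptimised semiring
    renaming (_×_ to _·_)
  open import Relation.Binary.Reasoning.Setoid setoid

  private
    ι : ℤ → Carrier
    ι (+ n)    = n · 1#
    ι -[1+ n ] = - (suc n · 1#)

    ι-neg : ∀ i → ι (ℤ.- i) ≈ - ι i
    ι-neg (+ zero)  = sym ε⁻¹≈ε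
    ι-neg (+ suc n) = refl
    ι-neg -[1+ n ]  = sym (⁻¹-involutive _)

    ι-⊖ : ∀ m n → ι (m ℤ.⊖ n) ≈ m · 1# - n · 1#
    ι-⊖ zero    zero    = sym (-‿inverseʳ _)
    ι-⊖ (suc m) zero    = sym (trans (+-congˡ ε⁻¹≈ε) (+-identityʳ _))
    ι-⊖ zero    (suc n) = sym (+-identityˡ _)
    ι-⊖ (suc m) (suc n) = begin
      ι (suc m ℤ.⊖ suc n)                    ≡⟨ ≡.cong ι (ℤ.[1+m]⊖[1+n]≡m⊖n m n) ⟩
      ι (m ℤ.⊖ n)                            ≈⟨ ι-⊖ m n ⟩
      m · 1# - n · 1#                        ≈⟨ +-congʳ (+-identityʳ _) ⟨
      m · 1# + 0# - n · 1#                   ≈⟨ +-congʳ (+-congˡ (-‿inverseʳ 1#)) ⟨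
      m · 1# + (1# - 1#) - n · 1#            ≈⟨ +-congʳ (+-assoc _ _ _) ⟨
      m · 1# + 1# - 1# - n · 1#              ≈⟨ +-congʳ (+-congʳ (+-comm _ _)) ⟩
      1# + m · 1# - 1# - n · 1#              ≈⟨ +-assoc _ _ _ ⟩
      1# + m · 1# + (- 1# - n · 1#)          ≈⟨ +-congˡ (⁻¹-∙-comm _ _) ⟩
      1# + m · 1# - (1# + n · 1#)            ≈⟨ +-cong (1+× m 1#) (-‿cong (1+× n 1#)) ⟨
      suc m · 1# - suc n · 1#                ∎

    ι-+ : ∀ i j → ι (i ℤ.+ j) ≈ ι i + ι j
    ι-+ (+ m)    (+ n)    = ×-homo-+ 1# m n
    ι-+ (+ m)    -[1+ n ] = ι-⊖ m (suc n)
    ι-+ -[1+ m ] (+ n)    = trans (ι-⊖ n (suc m)) (+-comm _ _)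
    ι-+ -[1+ m ] -[1+ n ] = begin
      - (suc (suc (m ℕ.+ n)) · 1#)     ≡⟨ ≡.cong (λ k → - (suc k · 1#)) (ℕ.+-suc m n) ⟨
      - ((suc m ℕ.+ suc n) · 1#)       ≈⟨ -‿cong (×-homo-+ 1# (suc m) (suc n)) ⟩
      - (suc m · 1# + suc n · 1#)      ≈⟨ ⁻¹-∙-comm _ _ ⟨
      - (suc m · 1#) - suc n · 1#      ∎

    ι-pos-* : ∀ m n → ι (+ m ℤ.* + n) ≈ ι (+ m) * ι (+ n)
    ι-pos-* m n = trans (reflexive (≡.cong ι (≡.sym (ℤ.pos-* m n)))) (×1-homo-* m n)

    ι-pos-*ˡ : ∀ m j → ι (+ m ℤ.* j) ≈ ι (+ m) * ι j
    ι-pos-*ˡ m (+ n)    = ι-pos-* m n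
    ι-pos-*ˡ m -[1+ n ] = begin
      ι (+ m ℤ.* -[1+ n ])          ≡⟨ ≡.cong ι (ℤ.neg-distribʳ-* (+ m) (+ suc n)) ⟨
      ι (ℤ.- (+ m ℤ.* + suc n))     ≈⟨ ι-neg (+ m ℤ.* + suc n) ⟩
      - ι (+ m ℤ.* + suc n)         ≈⟨ -‿cong (ι-pos-* m (suc n)) ⟩
      - (ι (+ m) * ι (+ suc n))     ≈⟨ -‿distribʳ-* _ _ ⟩
      ι (+ m) * - ι (+ suc n)       ∎

    ι-* : ∀ i j → ι (i ℤ.* j) ≈ ι i * ι j
    ι-* (+ m)    j = ι-pos-*ˡ m j
    ι-* -[1+ m ] j = begin
      ι (-[1+ m ] ℤ.* j)            ≡⟨ ≡.cong ι (ℤ.neg-distribˡ-* (+ suc m) j) ⟨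
      ι (ℤ.- (+ suc m ℤ.* j))       ≈⟨ ι-neg (+ suc m ℤ.* j) ⟩
      - ι (+ suc m ℤ.* j)           ≈⟨ -‿cong (ι-pos-*ˡ (suc m) j) ⟩
      - (ι (+ suc m) * ι j)         ≈⟨ -‿distribˡ-* _ _ ⟩
      - ι (+ suc m) * ι j           ∎

    morphism : ℤ.+-*-rawRing -Raw-AlmostCommutative⟶ fromCommutativeRing R
    morphism = record
      { ⟦_⟧    = ι
      ; +-homo = ι-+
      ; *-homo = ι-*
      ; -‿homo = ι-neg
      ; 0-homo = refl
      ; 1-homo = refl
      }

    _coeff≟_ : WeaklyDecidable (Induced-equivalence morphism)
    i coeff≟ j with i ℤ.≟ j
    ... | yes i≡j = just (reflexive (≡.cong ι i≡j))
    ... | no  _   = nothing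

  open import Algebra.Solver.Ring ℤ.+-*-rawRing (fromCommutativeRing R) morphism _coeff≟_ public
    using (Polynomial; solve; _:=_; con; _:+_; _:*_; _:-_; :-_)

-- Finite sums, products and Pochhammer symbols

module Sums {c ℓ} (R : CommutativeRing c ℓ) where
  open CommutativeRing R
  open import Algebra.Properties.Semiring.Exp semiring
  open import Relation.Binary.Reasoning.Setoid setoid
  open IntegerSolver R

  Σ< Π< : ℕ → (ℕ → Carrier) → Carrier
  Σ< zero    f = 0#
  Σ< (suc n) f = Σ< n f + f n
  Π< zero    f = 1#
  Π< (suc n) f = Π< n f * f n

  Σ<-cong : ∀ n {f g} → (∀ {i} → i < n → f i ≈ g i) → Σ< n f ≈ Σ< n g
  Σ<-cong zero    eq = refl
  Σ<-cong (suc n) eq = +-cong (Σ<-cong n λ i<n → eq (ℕ.m<n⇒m<1+n i<n)) (eq ℕ.≤-refl)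

  Π<-cong : ∀ n {f g} → (∀ i → f i ≈ g i) → Π< n f ≈ Π< n g
  Π<-cong zero    eq = refl
  Π<-cong (suc n) eq = *-cong (Π<-cong n eq) (eq n)

  Σ<-*ˡ : ∀ n k f → Σ< n (λ i → k * f i) ≈ k * Σ< n f
  Σ<-*ˡ zero    k f = sym (zeroʳ k)
  Σ<-*ˡ (suc n) k f = trans (+-congʳ (Σ<-*ˡ n k f)) (sym (distribˡ k _ _))

  Σ<-+ : ∀ n f g → Σ< n (λ i → f i + g i) ≈ Σ< n f + Σ< n g
  Σ<-+ zero    f g = sym (+-identityˡ 0#)
  Σ<-+ (suc n) f g = trans (+-congʳ (Σ<-+ n f g))
    (solve 4 (λ a b c d → a :+ b :+ (c :+ d) := a :+ c :+ (b :+ d)) refl _ _ _ _)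

  Σ<-suc : ∀ n f → Σ< (suc n) f ≈ f 0 + Σ< n (λ i → f (suc i))
  Σ<-suc zero    f = +-comm _ _
  Σ<-suc (suc n) f = trans (+-congʳ (Σ<-suc n f)) (+-assoc _ _ _)

  Π<-suc : ∀ n f → Π< (suc n) f ≈ f 0 * Π< n (λ i → f (suc i))
  Π<-suc zero    f = *-comm _ _
  Π<-suc (suc n) f = trans (*-congʳ (Π<-suc n f)) (*-assoc _ _ _)

  -- Summation with a certificate `r`: the difference of `f` and `g` is a difference of consecutive
  -- values of `r`, phrased without subtraction. It serves the finite triple product and both
  -- recurrences of `S₁` and `S₂`.
  telescope : ∀ (f g r : ℕ → Carrier) → (∀ n → f n + r (suc n) ≈ r n + g n) →
              ∀ n → Σ< n f + r n ≈ r 0 + Σ< n g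
  telescope f g r step zero    = +-comm _ _
  telescope f g r step (suc n) = begin
    Σ< n f + f n + r (suc n)      ≈⟨ +-assoc _ _ _ ⟩
    Σ< n f + (f n + r (suc n))    ≈⟨ +-congˡ (step n) ⟩
    Σ< n f + (r n + g n)          ≈⟨ +-assoc _ _ _ ⟨
    Σ< n f + r n + g n            ≈⟨ +-congʳ (telescope f g r step n) ⟩
    r 0 + Σ< n g + g n            ≈⟨ +-assoc _ _ _ ⟩
    r 0 + Σ< (suc n) g            ∎

  -- poch x n t = (1 − xⁿ⁺¹) ⋯ (1 − xⁿ⁺ᵗ)
  poch : Carrier → ℕ → ℕ → Carrier
  poch x n zero    = 1#
  poch x n (suc t) = poch x n t * (1# - x ^ (n ℕ.+ suc t))

  poch-suc : ∀ x n t → poch x n (suc t) ≈ poch x n t * (1# - x * x ^ t * x ^ n)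
  poch-suc x n t = *-congˡ (+-congˡ (-‿cong (begin
    x ^ (n ℕ.+ suc t)     ≈⟨ ^-homo-* x n (suc t) ⟩
    x ^ n * (x * x ^ t)   ≈⟨ *-comm _ _ ⟩
    x * x ^ t * x ^ n     ∎)))

  poch-shift : ∀ x n t → poch x (suc n) t * (1# - x * x ^ n) ≈ poch x n (suc t)
  poch-shift x n zero    = *-congˡ (+-congˡ (-‿cong
    (reflexive (≡.cong (x ^_) (ℕ.+-comm 1 n)))))
  poch-shift x n (suc t) = begin
    poch x (suc n) t * (1# - x ^ (suc n ℕ.+ suc t)) * (1# - x * x ^ n)
      ≈⟨ solve 3 (λ a b c → a :* b :* c := a :* c :* b) refl _ _ _ ⟩
    poch x (suc n) t * (1# - x * x ^ n) * (1# - x ^ (suc n ℕ.+ suc t))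
      ≈⟨ *-cong (poch-shift x n t)
           (reflexive (≡.cong (λ k → 1# - x ^ k) (≡.sym (ℕ.+-suc n (suc t))))) ⟩
    poch x n (suc (suc t)) ∎

-- Finite form of Jacobi's triple product

module FiniteTripleProduct {c ℓ} (R : CommutativeRing c ℓ)
  (a b : CommutativeRing.Carrier R) where
  open CommutativeRing R
  open import Algebra.Properties.Semiring.Exp semiring
  open import Relation.Binary.Reasoning.Setoid setoid
  open IntegerSolver R
  open Sums R

  private
    Q : Carrier
    Q = a * b

    :1 : ∀ {n} → Polynomial n
    :1 = con (+ 1)

  -- coef n j is the Gaussian binomial coefficient [2n choose n+j] in base ab.
  coef : ℕ → ℕ → Carrier
  coef zero    zero    = 1#
  coef zero    (suc j) = 0#
  coef (suc n) zero    = (1# + Q ^ n * Q ^ n * Q) * coef n 0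
                         + (Q ^ n * Q + Q ^ n * Q) * coef n 1
  coef (suc n) (suc j) = (1# + Q ^ n * Q ^ n * Q) * coef n (suc j)
                         + Q ^ (n ℕ.∸ j) * coef n j
                         + Q ^ n * Q ^ suc (suc j) * coef n (suc (suc j))

  coef-vanishes : ∀ {n j} → n < j → coef n j ≈ 0#
  coef-vanishes {zero}  {suc j} _         = refl
  coef-vanishes {suc n} {suc j} (s≤s n<j) = begin
    coef (suc n) (suc j)
      ≈⟨ +-cong (+-cong (*-congˡ (coef-vanishes (ℕ.m<n⇒m<1+n n<j)))
                        (*-congˡ (coef-vanishes n<j)))
                (*-congˡ (coef-vanishes (ℕ.m<n⇒m<1+n (ℕ.m<n⇒m<1+n n<j)))) ⟩
    _ * 0# + _ * 0# + _ * 0#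
      ≈⟨ solve 3 (λ x y z → x :* con (+ 0) :+ y :* con (+ 0) :+ z :* con (+ 0) := con (+ 0))
           refl _ _ _ ⟩
    0# ∎

  P : ℕ → Carrier
  P = poch Q 0

  -- The formula (Q)₂ₙ / ((Q)ₙ₊ⱼ (Q)ₙ₋ⱼ), cross-multiplied, with `i` for n - j and `k` for n + j. In
  -- the induction each neighbour j - 1, j, j + 1 in the previous row misses two factors of the
  -- common denominator. Where `i` is too small for the hypothesis, the neighbour vanishes, and so
  -- does the matching factor 1 - Q⁰ or Q - Q¹.
  coef-closed : ∀ n i j k → i ℕ.+ j ≡ n → n ℕ.+ j ≡ k →
                coef n j * (P k * P i) ≈ P (n ℕ.+ n)
  coef-closed zero zero zero .0 ≡.refl ≡.refl =
    solve 1 (λ x → :1 :* (:1 :* :1) := :1) refl Q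
  coef-closed (suc n) i zero k i+0≡1+n ≡.refl
    with ≡.refl ← ≡.trans (≡.sym (ℕ.+-identityʳ i)) i+0≡1+n
    rewrite ℕ.+-identityʳ n | ℕ.+-suc n n = begin
    ((1# + u * u * Q) * coef n 0 + (u * Q + u * Q) * coef n 1) * (P (suc n) * P (suc n))
      ≈⟨ solve 5 (λ x y z w p → (x :* y :+ z :* w) :* p := x :* (y :* p) :+ z :* (w :* p))
           refl _ _ _ _ _ ⟩
    (1# + u * u * Q) * (coef n 0 * (P (suc n) * P (suc n)))
      + (u * Q + u * Q) * (coef n 1 * (P (suc n) * P (suc n)))
      ≈⟨ +-cong (*-congˡ term₀) (*-congˡ (term₁ n ≡.refl)) ⟩
    (1# + u * u * Q) * (P (n ℕ.+ n) * ((1# - Q * u) * (1# - Q * u)))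
      + (u * Q + u * Q) * (P (n ℕ.+ n) * ((1# - u) * (1# - Q * u)))
      ≈⟨ solve 3 (λ u p Q →
           (:1 :+ u :* u :* Q) :* (p :* ((:1 :- Q :* u) :* (:1 :- Q :* u)))
             :+ (u :* Q :+ u :* Q) :* (p :* ((:1 :- u) :* (:1 :- Q :* u)))
           := p :* (:1 :- Q :* (u :* u)) :* (:1 :- Q :* (Q :* (u :* u))))
           refl u (P (n ℕ.+ n)) Q ⟩
    P (n ℕ.+ n) * (1# - Q * (u * u)) * (1# - Q * (Q * (u * u)))
      ≈⟨ *-cong (*-congˡ (+-congˡ (-‿cong (*-congˡ u*u))))
                (+-congˡ (-‿cong (*-congˡ (*-congˡ u*u)))) ⟩
    P (suc (suc (n ℕ.+ n))) ∎
    where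
    u = Q ^ n
    u*u : u * u ≈ Q ^ (n ℕ.+ n)
    u*u = sym (^-homo-* Q n n)
    term₀ : coef n 0 * (P (suc n) * P (suc n)) ≈ P (n ℕ.+ n) * ((1# - Q * u) * (1# - Q * u))
    term₀ = trans
      (solve 3 (λ c p x → c :* (p :* x :* (p :* x)) := c :* (p :* p) :* (x :* x)) refl _ _ _)
      (*-congʳ (coef-closed n n 0 n (ℕ.+-identityʳ n) (ℕ.+-identityʳ n)))
    term₁ : ∀ m → m ≡ n → coef m 1 * (P (suc m) * P (suc m)) ≈
            P (m ℕ.+ m) * ((1# - Q ^ m) * (1# - Q * Q ^ m))
    term₁ zero    ≡.refl = solve 2 (λ x y →
      con (+ 0) :* x := :1 :* ((:1 :- :1) :* y)) refl _ _
    term₁ (suc m) ≡.refl = trans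
      (solve 5 (λ c p₂ p₁ x y → c :* (p₂ :* (p₁ :* x :* y)) := c :* (p₂ :* p₁) :* (x :* y))
        refl _ _ _ _ _)
      (*-congʳ (coef-closed n m 1 (suc n) (ℕ.+-comm m 1) (ℕ.+-comm n 1)))
  coef-closed (suc n) i (suc j) k i+j≡n ≡.refl
    with ≡.refl ← ℕ.suc-injective (≡.trans (≡.sym (ℕ.+-suc i j)) i+j≡n)
    rewrite ℕ.+-suc n j | ℕ.+-suc n n = begin
    ((1# + h * h * Q) * coef n (suc j) + Q ^ (n ℕ.∸ j) * coef n j
       + h * Q ^ suc (suc j) * coef n (suc (suc j))) * (P (suc (suc k′)) * P i)
      ≈⟨ solve 7 (λ x c₁ y c₀ z c₂ p → (x :* c₁ :+ y :* c₀ :+ z :* c₂) :* p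
            := x :* (c₁ :* p) :+ y :* (c₀ :* p) :+ z :* (c₂ :* p)) refl _ _ _ _ _ _ _ ⟩
    (1# + h * h * Q) * (coef n (suc j) * (P (suc (suc k′)) * P i))
      + Q ^ (n ℕ.∸ j) * (coef n j * (P (suc (suc k′)) * P i))
      + h * Q ^ suc (suc j) * (coef n (suc (suc j)) * (P (suc (suc k′)) * P i))
      ≈⟨ +-cong (+-cong
           (*-cong (+-congˡ (*-congʳ h*h)) (term₁ i ≡.refl))
           (*-cong (reflexive (≡.cong (Q ^_) (ℕ.m+n∸n≡m i j))) term₀))
           (trans (*-congʳ h*Qʲ⁺²) (term₂ i ≡.refl)) ⟩
    (1# + u * g * Q) * (P (n ℕ.+ n) * ((1# - Q * (Q * g)) * (1# - u)))
      + u * (P (n ℕ.+ n) * ((1# - Q * g) * (1# - Q * (Q * g))))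
      + P (n ℕ.+ n) * ((1# - u) * (g * Q * (Q - u)))
      ≈⟨ solve 4 (λ u g p Q →
           (:1 :+ u :* g :* Q) :* (p :* ((:1 :- Q :* (Q :* g)) :* (:1 :- u)))
             :+ u :* (p :* ((:1 :- Q :* g) :* (:1 :- Q :* (Q :* g))))
             :+ p :* ((:1 :- u) :* (g :* Q :* (Q :- u)))
           := p :* (:1 :- Q :* (u :* g)) :* (:1 :- Q :* (Q :* (u :* g))))
           refl u g (P (n ℕ.+ n)) Q ⟩
    P (n ℕ.+ n) * (1# - Q * (u * g)) * (1# - Q * (Q * (u * g)))
      ≈⟨ *-cong (*-congˡ (+-congˡ (-‿cong (*-congˡ u*g))))
                (+-congˡ (-‿cong (*-congˡ (*-congˡ u*g)))) ⟩
    P (suc (suc (n ℕ.+ n))) ∎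
    where
    k′ = n ℕ.+ j
    u = Q ^ i
    h = Q ^ n
    g = Q ^ k′
    i+k′≡n+n : i ℕ.+ k′ ≡ n ℕ.+ n
    i+k′≡n+n = ≡.trans (≡.cong (i ℕ.+_) (ℕ.+-comm n j)) (≡.sym (ℕ.+-assoc i j n))
    u*g : u * g ≈ Q ^ (n ℕ.+ n)
    u*g = trans (sym (^-homo-* Q i k′)) (reflexive (≡.cong (Q ^_) i+k′≡n+n))
    h*h : h * h ≈ u * g
    h*h = trans (sym (^-homo-* Q n n)) (sym u*g)
    h*Qʲ⁺² : h * Q ^ suc (suc j) ≈ g * Q * Q
    h*Qʲ⁺² = trans
      (solve 3 (λ h Q y → h :* (Q :* (Q :* y)) := h :* y :* Q :* Q) refl h Q (Q ^ j))
      (*-congʳ (*-congʳ (sym (^-homo-* Q n j))))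
    term₀ : coef n j * (P (suc (suc k′)) * P i) ≈
            P (n ℕ.+ n) * ((1# - Q * g) * (1# - Q * (Q * g)))
    term₀ = trans
      (solve 5 (λ c p x y r → c :* (p :* x :* y :* r) := c :* (p :* r) :* (x :* y))
        refl _ _ _ _ _)
      (*-congʳ (coef-closed n i j k′ ≡.refl ≡.refl))
    term₁ : ∀ l → l ≡ i → coef n (suc j) * (P (suc (suc k′)) * P l) ≈
            P (n ℕ.+ n) * ((1# - Q * (Q * g)) * (1# - Q ^ l))
    term₁ zero    ≡.refl = trans (*-congʳ (coef-vanishes {n} {suc j} ℕ.≤-refl))
      (solve 3 (λ x y z → con (+ 0) :* x := y :* (z :* (:1 :- :1))) refl _ _ _)
    term₁ (suc l) ≡.refl = trans
      (solve 5 (λ c p x r y → c :* (p :* x :* (r :* y)) := c :* (p :* r) :* (x :* y))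
        refl _ _ _ _ _)
      (*-congʳ (coef-closed n l (suc j) (suc k′) (ℕ.+-suc l j) (ℕ.+-suc n j)))
    -- Q (1 - Qˡ⁻¹) is written as Q - Qˡ, which also makes sense at `l = 0`.
    term₂ : ∀ l → l ≡ i → g * Q * Q * (coef n (suc (suc j)) * (P (suc (suc k′)) * P l)) ≈
            P (n ℕ.+ n) * ((1# - Q ^ l) * (g * Q * (Q - Q ^ l)))
    term₂ zero ≡.refl = trans
      (*-congˡ (*-congʳ (coef-vanishes {n} {suc (suc j)} (ℕ.n≤1+n _))))
      (solve 4 (λ x w y z → w :* (con (+ 0) :* x) := y :* ((:1 :- :1) :* z)) refl _ _ _ _)
    term₂ (suc zero) ≡.refl = trans
      (*-congˡ (*-congʳ (coef-vanishes {n} {suc (suc j)} ℕ.≤-refl)))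
      (solve 6 (λ x w y z v Q → w :* (con (+ 0) :* x) := y :* (z :* (v :* (Q :- Q :* :1))))
        refl _ _ _ _ _ _)
    term₂ (suc (suc l)) ≡.refl = trans
      (solve 6 (λ g Q c p r y →
         g :* Q :* Q :* (c :* (p :* (r :* (:1 :- Q :* y) :* (:1 :- Q :* (Q :* y)))))
         := c :* (p :* r) :* ((:1 :- Q :* (Q :* y)) :* (g :* Q :* (Q :- Q :* (Q :* y)))))
        refl g Q _ _ _ (Q ^ l))
      (*-congʳ (coef-closed n l (suc (suc j)) (suc (suc k′))
        (≡.trans (ℕ.+-suc l (suc j)) (≡.cong suc (ℕ.+-suc l j)))
        (≡.trans (ℕ.+-suc n (suc j)) (≡.cong suc (ℕ.+-suc n j)))))

  -- θ x j = (−x)ʲ Qʲ⁽ʲ⁻¹⁾ᐟ² for Q = ab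
  θ : Carrier → ℕ → Carrier
  θ x zero    = 1#
  θ x (suc j) = - (θ x j * (a * b) ^ j * x)

  triple : ℕ → Carrier
  triple n = Π< n (λ i → (1# - a * Q ^ i) * (1# - b * Q ^ i))

  -- Passing from `θ x j` to `θ x (suc j)` contributes -Qʲx, and Qʲ Qⁿ⁻ʲ = Qⁿ. For j > n the
  -- truncated exponent n ∸ j breaks this, but there `coef n j` is zero.
  θ-coef : ∀ x n j → θ x (suc j) * (Q ^ (n ℕ.∸ j) * coef n j) ≈ - (x * Q ^ n * (θ x j * coef n j))
  θ-coef x n j with j ℕ.≤? n
  ... | yes j≤n = begin
    - (θ x j * Q ^ j * x) * (Q ^ (n ℕ.∸ j) * coef n j)
      ≈⟨ solve 5 (λ t y x z c → :- (t :* y :* x) :* (z :* c) := :- (x :* (y :* z) :* (t :* c)))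
           refl _ _ _ _ _ ⟩
    - (x * (Q ^ j * Q ^ (n ℕ.∸ j)) * (θ x j * coef n j))
      ≈⟨ -‿cong (*-congʳ (*-congˡ (trans (sym (^-homo-* Q j (n ℕ.∸ j)))
           (reflexive (≡.cong (Q ^_) (ℕ.m+[n∸m]≡n j≤n)))))) ⟩
    - (x * Q ^ n * (θ x j * coef n j)) ∎
  ... | no j≰n = begin
    θ x (suc j) * (Q ^ (n ℕ.∸ j) * coef n j)
      ≈⟨ *-congˡ (*-congˡ c≈0) ⟩
    θ x (suc j) * (Q ^ (n ℕ.∸ j) * 0#)
      ≈⟨ solve 4 (λ u v w z → u :* (v :* con (+ 0)) := :- (w :* (z :* con (+ 0)))) refl _ _ _ _ ⟩
    - (x * Q ^ n * (θ x j * 0#))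
      ≈⟨ -‿cong (*-congˡ (*-congˡ (sym c≈0))) ⟩
    - (x * Q ^ n * (θ x j * coef n j)) ∎
    where
    c≈0 : coef n j ≈ 0#
    c≈0 = coef-vanishes (ℕ.≰⇒> j≰n)

  private
    series : ℕ → ℕ → Carrier
    series n m = coef n 0 + Σ< m (λ j → (θ a (suc j) + θ b (suc j)) * coef n (suc j))

    -- Net transfer between the indices j and j + 1 under multiplication by (1 - aQⁿ)(1 - bQⁿ): on
    -- the `θ a` branch -aQⁿ moves a term up and -bQⁿ moves it down, on the `θ b` branch the other
    -- way round.
    remainder : ℕ → ℕ → Carrier
    remainder n j = Q ^ n * (b * θ a (suc j) + a * θ b (suc j)) * coef n (suc j)
                    - Q ^ n * (a * θ a j + b * θ b j) * coef n j

    -- The recurrence of `coef` is multiplication by the next pair of factors, read off at each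
    -- index; `remainder n m` is what crosses the cut at `m`. Row 0 of the recurrence has a doubled
    -- term because the coefficients at 1 and -1 coincide.
    series-suc : ∀ n m → series (suc n) m + remainder n m ≈
                 (1# - a * Q ^ n) * (1# - b * Q ^ n) * series n m
    series-suc n m = begin
      coef (suc n) 0 + Σ< m f + remainder n m
        ≈⟨ +-assoc _ _ _ ⟩
      coef (suc n) 0 + (Σ< m f + remainder n m)
        ≈⟨ +-congˡ (telescope f (λ j → K * e j) (remainder n) step m) ⟩
      coef (suc n) 0 + (remainder n 0 + Σ< m (λ j → K * e j))
        ≈⟨ +-congˡ (+-congˡ (Σ<-*ˡ m K e)) ⟩
      coef (suc n) 0 + (remainder n 0 + K * Σ< m e)
        ≈⟨ solve 6 (λ a b h c₀ c₁ s →
             (:1 :+ h :* h :* (a :* b)) :* c₀ :+ (h :* (a :* b) :+ h :* (a :* b)) :* c₁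
             :+ (h :* (b :* (:- (:1 :* :1 :* a)) :+ a :* (:- (:1 :* :1 :* b))) :* c₁
                 :- h :* (a :* :1 :+ b :* :1) :* c₀
                 :+ (:1 :- a :* h) :* (:1 :- b :* h) :* s)
             := (:1 :- a :* h) :* (:1 :- b :* h) :* (c₀ :+ s))
             refl a b (Q ^ n) (coef n 0) (coef n 1) (Σ< m e) ⟩
      K * series n m ∎
      where
      K = (1# - a * Q ^ n) * (1# - b * Q ^ n)
      e f : ℕ → Carrier
      e j = (θ a (suc j) + θ b (suc j)) * coef n (suc j)
      f j = (θ a (suc j) + θ b (suc j)) * coef (suc n) (suc j)
      step : ∀ j → f j + remainder n (suc j) ≈ remainder n j + K * e j
      step j = begin
        (t₁ + t₂) * (H * c₁ + L + h * Q ^ suc (suc j) * c₂) + remainder n (suc j)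
          ≈⟨ +-congʳ (solve 6 (λ t₁ t₂ x l y c₂ → (t₁ :+ t₂) :* (x :+ l :+ y :* c₂)
               := t₁ :* l :+ t₂ :* l :+ (t₁ :+ t₂) :* (x :+ y :* c₂)) refl t₁ t₂ _ _ _ c₂) ⟩
        t₁ * L + t₂ * L + (t₁ + t₂) * (H * c₁ + h * Q ^ suc (suc j) * c₂) + remainder n (suc j)
          ≈⟨ +-congʳ (+-congʳ (+-cong (θ-coef a n j) (θ-coef b n j))) ⟩
        - (a * h * (θ a j * c₀)) + - (b * h * (θ b j * c₀))
          + (t₁ + t₂) * (H * c₁ + h * Q ^ suc (suc j) * c₂) + remainder n (suc j)
          ≈⟨ solve 11 (λ a b h y t₁ t₂ θa θb c₀ c₁ c₂ →
               :- (a :* h :* (θa :* c₀)) :+ :- (b :* h :* (θb :* c₀))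
               :+ (t₁ :+ t₂) :* ((:1 :+ h :* h :* (a :* b)) :* c₁ :+ h :* (a :* b :* y) :* c₂)
               :+ (h :* (b :* (:- (t₁ :* y :* a)) :+ a :* (:- (t₂ :* y :* b))) :* c₂
                   :- h :* (a :* t₁ :+ b :* t₂) :* c₁)
               := (h :* (b :* t₁ :+ a :* t₂) :* c₁ :- h :* (a :* θa :+ b :* θb) :* c₀)
                  :+ (:1 :- a :* h) :* (:1 :- b :* h) :* ((t₁ :+ t₂) :* c₁))
               refl a b h (Q ^ suc j) t₁ t₂ (θ a j) (θ b j) c₀ c₁ c₂ ⟩
        remainder n j + K * e j ∎
        where
        h = Q ^ n
        H = 1# + h * h * Q
        t₁ = θ a (suc j)
        t₂ = θ b (suc j)
        c₀ = coef n j
        c₁ = coef n (suc j)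
        c₂ = coef n (suc (suc j))
        L = Q ^ (n ℕ.∸ j) * c₀

  -- With `a` and `b` in place of z and Q/z, the bilateral sum splits into two one-sided sums
  -- without negative powers. Every `m` above `n` serves, since `coef n` vanishes beyond n.
  finite-triple-product : ∀ {n m} → n < m →
    triple n ≈ coef n 0 + Σ< m (λ j → (θ a (suc j) + θ b (suc j)) * coef n (suc j))
  finite-triple-product {zero} {m} _ = sym (begin
    1# + Σ< m (λ j → (θ a (suc j) + θ b (suc j)) * 0#)  ≈⟨ +-congˡ (zeros m) ⟩
    1# + 0#                                             ≈⟨ +-identityʳ 1# ⟩
    1#                                                  ∎)
    where
    zeros : ∀ m → Σ< m (λ j → (θ a (suc j) + θ b (suc j)) * 0#) ≈ 0#
    zeros zero    = refl
    zeros (suc m) = trans (+-cong (zeros m) (zeroʳ _)) (+-identityˡ 0#)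
  finite-triple-product {suc n} {m} n<m = begin
    triple n * K                              ≈⟨ *-comm _ _ ⟩
    K * triple n                              ≈⟨ *-congˡ (finite-triple-product n<m′) ⟩
    K * series n m                            ≈⟨ series-suc n m ⟨
    series (suc n) m + remainder n m          ≈⟨ +-congˡ (+-cong
      (*-congˡ (coef-vanishes (ℕ.m<n⇒m<1+n n<m′)))
      (-‿cong (*-congˡ (coef-vanishes n<m′)))) ⟩
    series (suc n) m + (_ * 0# - _ * 0#)      ≈⟨ solve 3 (λ s x y →
      s :+ (x :* con (+ 0) :- y :* con (+ 0)) := s) refl _ _ _ ⟩
    series (suc n) m                          ∎
    where
    K = (1# - a * Q ^ n) * (1# - b * Q ^ n)
    n<m′ : n < m
    n<m′ = ℕ.<-trans (ℕ.n<1+n n) n<m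

-- Recurrences of Rogers and Andrews

module RogersRamanujan {c ℓ} (R : CommutativeRing c ℓ)

  (q : CommutativeRing.Carrier R) where
  open CommutativeRing R hiding (zero)
  open import Algebra.Properties.Semiring.Exp semiring
  open import Relation.Binary.Reasoning.Setoid setoid
  open IntegerSolver R
  open Sums R

  private
    :1 : ∀ {n} → Polynomial n
    :1 = con (+ 1)

  -- The depth `f` cuts the recursion off at 1; modulo qᴺ this is exact as soon as N ≤ f + m.
  α : ℕ → ℕ → Carrier
  α zero    m = 1#
  α (suc f) m = α f (suc m) + q ^ m * α f (suc (suc m))

  -- γ x n = (−1)ⁿ x²ⁿ q^(n(5n+1)/2)
  γ : Carrier → ℕ → Carrier
  γ x zero    = 1#
  γ x (suc n) = - (γ x n * (x * x * ((q ^ n) ^ 5 * q ^ 3)))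

  -- Summed over n these are (q)∞ times Andrews' Q₂,₁(qᵗ) and Q₂,₂(qᵗ); the
  -- factor (q)∞ clears all denominators.
  S₁ S₂ : ℕ → ℕ → Carrier
  S₁ t n = γ (q ^ t) n * q ^ n * (1# - q ^ t * ((q ^ n) ^ 2 * q)) * poch q n t
  S₂ t n = γ (q ^ t) n * (1# - (q ^ t) ^ 2 * ((q ^ n) ^ 4 * q ^ 2)) * poch q n t

  -- `x` enters `γ x n` as x²ⁿ. The factor q²ⁿ gained here is what lets the telescoping steps pass
  -- from t to t + 1.
  γ-shift : ∀ x n → γ (q * x) n ≈ γ x n * (q ^ n) ^ 2
  γ-shift x zero    = solve 1 (λ x → :1 := :1 :* (:1 :* (:1 :* :1))) refl x
  γ-shift x (suc n) = begin
    - (γ (q * x) n * (q * x * (q * x) * (y ^ 5 * q ^ 3)))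
      ≈⟨ -‿cong (*-congʳ (γ-shift x n)) ⟩
    - (γ x n * y ^ 2 * (q * x * (q * x) * (y ^ 5 * q ^ 3)))
      ≈⟨ solve 4 (λ g y q x → :- (g :* (y :* (y :* :1)) :* (q :* x :* (q :* x) :* z y q))
           := :- (g :* (x :* x :* z y q)) :* (q :* y :* (q :* y :* :1)))
           refl _ y q x ⟩
    γ x (suc n) * (q ^ suc n) ^ 2 ∎
    where
    y = q ^ n
    z : ∀ {n} → Polynomial n → Polynomial n → Polynomial n
    z y q = y :* (y :* (y :* (y :* (y :* :1)))) :* (q :* (q :* (q :* :1)))

  -- Far below the true order n(5n+1)/2, but enough to make `γ x n` vanish from n = N on.
  γ-divisible : ∀ x n → ∃[ r ] γ x n ≈ q ^ n * r
  γ-divisible x zero    = 1# , sym (*-identityˡ 1#)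
  γ-divisible x (suc n) = _ ,
    solve 4 (λ g y q x → :- (g :* (x :* x :* (y :* (y :* (y :* (y :* (y :* :1)))) :* (q :* (q :* (q :* :1))))))
      := q :* y :* :- (g :* x :* x :* y :* y :* y :* y :* q :* q)) refl (γ x n) (q ^ n) q x

  private
    -- Certificates that vanish at both ends: at n = 0 through 1 - qⁿ, at large n through `γ`. After
    -- division by (q)∞ the factor 1 - qⁿ turns the denominator (q)ₙ into (q)ₙ₋₁, which is what
    -- makes the index shift possible.
    rem₁ rem₂ : ℕ → ℕ → Carrier
    rem₁ t n = γ (q ^ t) n * q ^ n * (poch q n t * (1# - q ^ n))
    rem₂ t n = γ (q ^ t) n * (poch q n t * (1# - q ^ n))

    poch-step : ∀ n t → poch q (suc n) t * (1# - q * q ^ n) ≈ poch q n t * (1# - q * q ^ t * q ^ n)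
    poch-step n t = trans (poch-shift q n t) (poch-suc q n t)

    step₁ : ∀ t n → S₁ t n + rem₁ t (suc n) ≈ rem₁ t n + S₂ (suc t) n
    step₁ t n = begin
      S₁ t n + γ x (suc n) * (q * y) * (poch q (suc n) t * (1# - q * y))
        ≈⟨ +-congˡ (*-congˡ (poch-step n t)) ⟩
      S₁ t n + γ x (suc n) * (q * y) * (p * (1# - q * x * y))
        ≈⟨ solve 5 (λ g x y q p →
             g :* y :* (:1 :- x :* (y :* (y :* :1) :* q)) :* p
             :+ :- (g :* (x :* x :* (y⁵ y :* (q :* (q :* (q :* :1)))))) :* (q :* y)
                :* (p :* (:1 :- q :* x :* y))
             := g :* y :* (p :* (:1 :- y))
             :+ g :* (y :* (y :* :1)) :* (:1 :- q :* x :* (q :* x :* :1)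
                :* (y :* (y :* (y :* (y :* :1))) :* (q :* (q :* :1))))
                :* (p :* (:1 :- q :* x :* y)))
             refl (γ x n) x y q p ⟩
      rem₁ t n + γ x n * y ^ 2 * (1# - (q * x) ^ 2 * (y ^ 4 * q ^ 2)) * (p * (1# - q * x * y))
        ≈⟨ +-congˡ (*-cong (*-congʳ (γ-shift x n)) (poch-suc q n t)) ⟨
      rem₁ t n + S₂ (suc t) n ∎
      where
      x = q ^ t
      y = q ^ n
      p = poch q n t
      y⁵ : ∀ {n} → Polynomial n → Polynomial n
      y⁵ y = y :* (y :* (y :* (y :* (y :* :1))))

    step₂ : ∀ t n → S₂ t n + rem₂ t (suc n) ≈ rem₂ t n + (S₁ t n + q ^ suc t * S₁ (suc t) n)
    step₂ t n = begin
      S₂ t n + γ x (suc n) * (poch q (suc n) t * (1# - q * y))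
        ≈⟨ +-congˡ (*-congˡ (poch-step n t)) ⟩
      S₂ t n + γ x (suc n) * (p * (1# - q * x * y))
        ≈⟨ solve 5 (λ g x y q p →
             g :* (:1 :- x :* (x :* :1) :* (y :* (y :* (y :* (y :* :1))) :* (q :* (q :* :1)))) :* p
             :+ :- (g :* (x :* x :* (y⁵ y :* (q :* (q :* (q :* :1))))))
                :* (p :* (:1 :- q :* x :* y))
             := g :* (p :* (:1 :- y))
             :+ (g :* y :* (:1 :- x :* (y :* (y :* :1) :* q)) :* p
                :+ q :* x :* (g :* (y :* (y :* :1)) :* y
                     :* (:1 :- q :* x :* (y :* (y :* :1) :* q))
                     :* (p :* (:1 :- q :* x :* y)))))
             refl (γ x n) x y q p ⟩
      rem₂ t n + (S₁ t n + q * x * (γ x n * y ^ 2 * y * (1# - q * x * (y ^ 2 * q)) * (p * (1# - q * x * y))))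
        ≈⟨ +-congˡ (+-congˡ (*-congˡ (*-cong (*-congʳ (*-congʳ (γ-shift x n))) (poch-suc q n t)))) ⟨
      rem₂ t n + (S₁ t n + q ^ suc t * S₁ (suc t) n) ∎
      where
      x = q ^ t
      y = q ^ n
      p = poch q n t
      y⁵ : ∀ {n} → Polynomial n → Polynomial n
      y⁵ y = y :* (y :* (y :* (y :* (y :* :1))))

  -- Nilpotent q: cancellation, stable products and the sum side

  module Nilpotent (N : ℕ) (qᴺ≈0 : q ^ N ≈ 0#) where

    q^-vanishes : ∀ {n} → N ≤ n → q ^ n ≈ 0#
    q^-vanishes {n} N≤n = begin
      q ^ n                       ≡⟨ ≡.cong (q ^_) (ℕ.m+[n∸m]≡n N≤n) ⟨
      q ^ (N ℕ.+ (n ℕ.∸ N))       ≈⟨ ^-homo-* q N _ ⟩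
      q ^ N * q ^ (n ℕ.∸ N)       ≈⟨ *-congʳ qᴺ≈0 ⟩
      0# * q ^ (n ℕ.∸ N)          ≈⟨ zeroˡ _ ⟩
      0#                          ∎

    Cancellable : Carrier → Set _
    Cancellable u = ∀ {x y} → u * x ≈ u * y → x ≈ y

    cancellable-1 : Cancellable 1#
    cancellable-1 eq = trans (sym (*-identityˡ _)) (trans eq (*-identityˡ _))

    cancellable-* : ∀ {u v} → Cancellable u → Cancellable v → Cancellable (u * v)
    cancellable-* cu cv eq = cv (cu (trans (sym (*-assoc _ _ _)) (trans eq (*-assoc _ _ _))))

    cancellable-Π : ∀ n {f} → (∀ i → Cancellable (f i)) → Cancellable (Π< n f)
    cancellable-Π zero    c = cancellable-1
    cancellable-Π (suc n) c = cancellable-* (cancellable-Π n c) (c n)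

    -- z = qrz implies z = qⁿrⁿz for every n.
    cancellable-1-q* : ∀ r → Cancellable (1# - q * r)
    cancellable-1-q* r {x} {y} eq = begin
      x            ≈⟨ solve 2 (λ x y → x := x :- y :+ y) refl x y ⟩
      x - y + y    ≈⟨ +-congʳ (trans (proj₂ (divisible N)) (trans (*-congʳ qᴺ≈0) (zeroˡ _))) ⟩
      0# + y       ≈⟨ +-identityˡ y ⟩
      y            ∎
      where
      z = x - y
      fixed : z ≈ q * r * z
      fixed = begin
        z
          ≈⟨ solve 3 (λ x y s → x :- y := ((:1 :- s) :* x :- (:1 :- s) :* y) :+ s :* (x :- y))
               refl x y (q * r) ⟩
        (1# - q * r) * x - (1# - q * r) * y + q * r * z
          ≈⟨ +-congʳ (trans (+-congʳ eq) (-‿inverseʳ _)) ⟩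
        0# + q * r * z
          ≈⟨ +-identityˡ _ ⟩
        q * r * z ∎
      divisible : ∀ n → ∃[ w ] z ≈ q ^ n * w
      divisible zero    = z , sym (*-identityˡ z)
      divisible (suc n) with w , z≈ ← divisible n = r * w , (begin
        z                     ≈⟨ fixed ⟩
        q * r * z             ≈⟨ *-congˡ z≈ ⟩
        q * r * (q ^ n * w)   ≈⟨ solve 4 (λ q r y w → q :* r :* (y :* w) := q :* y :* (r :* w))
                                   refl q r _ w ⟩
        q ^ suc n * (r * w)   ∎)

    poch-stable : ∀ x → x ^ N ≈ 0# → ∀ {m} → N ≤ m → poch x 0 m ≈ poch x 0 N
    poch-stable x xᴺ≈0 {m} N≤m = begin
      poch x 0 m                        ≡⟨ ≡.cong (poch x 0) (ℕ.m∸n+n≡m N≤m) ⟨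
      poch x 0 (m ℕ.∸ N ℕ.+ N)          ≈⟨ go (m ℕ.∸ N) ⟩
      poch x 0 N                        ∎
      where
      go : ∀ k → poch x 0 (k ℕ.+ N) ≈ poch x 0 N
      go zero    = refl
      go (suc k) = begin
        poch x 0 (k ℕ.+ N) * (1# - x ^ (suc k ℕ.+ N))  ≈⟨ *-cong (go k) (+-congˡ (-‿cong (begin
          x ^ (suc k ℕ.+ N)                               ≈⟨ ^-homo-* x (suc k) N ⟩
          x ^ suc k * x ^ N                               ≈⟨ *-congˡ xᴺ≈0 ⟩
          x ^ suc k * 0#                                  ≈⟨ zeroʳ _ ⟩
          0#                                              ∎))) ⟩
        poch x 0 N * (1# - 0#)                         ≈⟨ solve 1 (λ p → p :* (:1 :- con (+ 0)) := p) refl _ ⟩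
        poch x 0 N                                     ∎

    γ-vanishes : ∀ x {n} → N ≤ n → γ x n ≈ 0#
    γ-vanishes x {n} N≤n with r , γ≈ ← γ-divisible x n =
      trans γ≈ (trans (*-congʳ (q^-vanishes N≤n)) (zeroˡ r))

    module _ {M : ℕ} (N≤M : N ≤ M) where

      -- Andrews' relation Q₂,ᵢ(x) - Q₂,ᵢ₋₁(x) = (xq)ⁱ⁻¹ Q₂,₃₋ᵢ(xq) at x = qᵗ and i = 1, where Q₂,₀
      -- = 0. The partial sums agree because `rem₁` vanishes at 0 and at M.
      S₁≈S₂ : ∀ t → Σ< M (S₁ t) ≈ Σ< M (S₂ (suc t))
      S₁≈S₂ t = begin
        Σ< M (S₁ t)                    ≈⟨ +-identityʳ _ ⟨
        Σ< M (S₁ t) + 0#               ≈⟨ +-congˡ (trans (*-congʳ (*-congʳ (γ-vanishes _ N≤M)))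
          (solve 2 (λ x y → con (+ 0) :* x :* y := con (+ 0)) refl _ _)) ⟨
        Σ< M (S₁ t) + rem₁ t M         ≈⟨ telescope (S₁ t) (S₂ (suc t)) (rem₁ t) (step₁ t) M ⟩
        rem₁ t 0 + Σ< M (S₂ (suc t))   ≈⟨ solve 2 (λ p s → :1 :* :1 :* (p :* (:1 :- :1)) :+ s := s) refl _ _ ⟩
        Σ< M (S₂ (suc t))              ∎

      -- The same relation for i = 2, with certificate `rem₂`.
      S₂≈S₁+S₁ : ∀ t → Σ< M (S₂ t) ≈ Σ< M (S₁ t) + q ^ suc t * Σ< M (S₁ (suc t))
      S₂≈S₁+S₁ t = begin
        Σ< M (S₂ t)                    ≈⟨ +-identityʳ _ ⟨
        Σ< M (S₂ t) + 0#               ≈⟨ +-congˡ (trans (*-congʳ (γ-vanishes _ N≤M)) (zeroˡ _)) ⟨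
        Σ< M (S₂ t) + rem₂ t M         ≈⟨ telescope (S₂ t) _ (rem₂ t) (step₂ t) M ⟩
        rem₂ t 0 + Σ< M (λ n → S₁ t n + q ^ suc t * S₁ (suc t) n)
          ≈⟨ +-congˡ (Σ<-+ M _ _) ⟩
        rem₂ t 0 + (Σ< M (S₁ t) + Σ< M (λ n → q ^ suc t * S₁ (suc t) n))
          ≈⟨ solve 2 (λ p s → :1 :* (p :* (:1 :- :1)) :+ s := s) refl _ _ ⟩
        Σ< M (S₁ t) + Σ< M (λ n → q ^ suc t * S₁ (suc t) n)
          ≈⟨ +-congˡ (Σ<-*ˡ M _ _) ⟩
        Σ< M (S₁ t) + q ^ suc t * Σ< M (S₁ (suc t)) ∎

    module _ {M : ℕ} (N≤1+M : N ≤ suc M) where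

      -- Once qᵗ = 0, every term with n > 0 contains it through `γ`, and the term at n = 0 is (q)ₜ,
      -- already stable.
      S₂-stable : ∀ {t} → N ≤ t → Σ< (suc M) (S₂ t) ≈ poch q 0 N
      S₂-stable {t} N≤t = begin
        Σ< (suc M) (S₂ t)                        ≈⟨ Σ<-suc M (S₂ t) ⟩
        S₂ t 0 + Σ< M (λ n → S₂ t (suc n))       ≈⟨ +-cong head (zeros M) ⟩
        poch q 0 N + 0#                          ≈⟨ +-identityʳ _ ⟩
        poch q 0 N                               ∎
        where
        x≈0 : q ^ t ≈ 0#
        x≈0 = q^-vanishes N≤t
        head : S₂ t 0 ≈ poch q 0 N
        head = begin
          S₂ t 0                                 ≈⟨ *-congʳ (*-congˡ (+-congˡ (-‿cong (*-congʳ (*-congʳ x≈0))))) ⟩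
          1# * (1# - 0# * (q ^ t * 1#) * _) * poch q 0 t
            ≈⟨ solve 3 (λ x y p → :1 :* (:1 :- con (+ 0) :* x :* y) :* p := p) refl _ _ _ ⟩
          poch q 0 t                             ≈⟨ poch-stable q qᴺ≈0 N≤t ⟩
          poch q 0 N                             ∎
        γ≈0 : ∀ n → γ (q ^ t) (suc n) ≈ 0#
        γ≈0 n = trans (-‿cong (*-congˡ (*-congʳ (*-congʳ x≈0))))
          (solve 3 (λ g x y → :- (g :* (con (+ 0) :* x :* y)) := con (+ 0)) refl _ _ _)
        zeros : ∀ m → Σ< m (λ n → S₂ t (suc n)) ≈ 0#
        zeros zero    = refl
        zeros (suc m) = trans (+-cong (zeros m) (*-congʳ (*-congʳ (γ≈0 m))))
          (solve 2 (λ x y → con (+ 0) :+ con (+ 0) :* x :* y := con (+ 0)) refl _ _)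

      -- Eliminating `S₁` between its two relations leaves for `S₂` the recurrence of `α` with m = t
      -- + 1. When the depth is exhausted, the hypothesis gives N ≤ t, and `S₂-stable` supplies the
      -- same starting value.
      α-S₂ : ∀ f t → N ≤ f ℕ.+ t → α f (suc t) * poch q 0 N ≈ Σ< (suc M) (S₂ t)
      α-S₂ zero    t N≤ = trans (*-identityˡ _) (sym (S₂-stable N≤))
      α-S₂ (suc f) t N≤ = begin
        (α f (suc (suc t)) + q ^ suc t * α f (suc (suc (suc t)))) * E
          ≈⟨ solve 4 (λ x y z w → (x :+ y :* z) :* w := x :* w :+ y :* (z :* w)) refl _ _ _ _ ⟩
        α f (suc (suc t)) * E + q ^ suc t * (α f (suc (suc (suc t))) * E)
          ≈⟨ +-cong (α-S₂ f (suc t) N≤′)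
               (*-congˡ (α-S₂ f (suc (suc t)) (ℕ.≤-trans N≤′ (ℕ.+-monoʳ-≤ f (ℕ.n≤1+n _))))) ⟩
        Σ< (suc M) (S₂ (suc t)) + q ^ suc t * Σ< (suc M) (S₂ (suc (suc t)))
          ≈⟨ +-cong (S₁≈S₂ N≤1+M t) (*-congˡ (S₁≈S₂ N≤1+M (suc t))) ⟨
        Σ< (suc M) (S₁ t) + q ^ suc t * Σ< (suc M) (S₁ (suc t))
          ≈⟨ S₂≈S₁+S₁ N≤1+M t ⟨
        Σ< (suc M) (S₂ t) ∎
        where
        E = poch q 0 N
        N≤′ : N ≤ f ℕ.+ suc t
        N≤′ = ≡.subst (N ≤_) (≡.sym (ℕ.+-suc f t)) N≤

    cancellable-resp : ∀ {u v} → u ≈ v → Cancellable u → Cancellable v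
    cancellable-resp u≈v cu eq = cu (trans (*-congʳ u≈v) (trans eq (*-congʳ (sym u≈v))))

    -- The theta series and the product modulo 5

    private
      -- This choice gives base q⁵ and the factors with exponents 1 and 4 modulo 5. Together with
      -- the multiples of 5 they are what (q)∞ has beyond the residues 2 and 3.
      open FiniteTripleProduct R q (q ^ 4)

      Q : Carrier
      Q = q * q ^ 4

      -- Twice N, so that for every j ≤ N both K - j and K + j are at least N and `coef K j` has
      -- reached its limit.
      K : ℕ
      K = N ℕ.+ N

      Q^n≈q^[n*5] : ∀ n → Q ^ n ≈ q ^ (n ℕ.* 5)
      Q^n≈q^[n*5] n = trans (^-assocʳ q 5 n) (reflexive (≡.cong (q ^_) (ℕ.*-comm 5 n)))

      Q^n≈q^n^5 : ∀ n → Q ^ n ≈ (q ^ n) ^ 5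
      Q^n≈q^n^5 n = trans (Q^n≈q^[n*5] n) (sym (^-assocʳ q n 5))

      Q^N≈0 : Q ^ N ≈ 0#
      Q^N≈0 = trans (Q^n≈q^[n*5] N) (q^-vanishes (ℕ.m≤m*n N 5))

      E₅ : Carrier
      E₅ = poch Q 0 N

      cancellable-poch-Q : ∀ n → Cancellable (poch Q 0 n)
      cancellable-poch-Q zero    = cancellable-1
      cancellable-poch-Q (suc n) = cancellable-* (cancellable-poch-Q n)
        (cancellable-resp (+-congˡ (-‿cong (sym (*-assoc q (q ^ 4) (Q ^ n)))))
          (cancellable-1-q* (q ^ 4 * Q ^ n)))

      -- The limit 1/(Q)∞ of the Gaussian binomials. It is attained exactly, since all three
      -- Pochhammer products in `coef-closed` are past index N.
      E₅*coef : ∀ {n j} → j ℕ.+ N ≤ n → E₅ * coef n j ≈ 1#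
      E₅*coef {n} {j} j+N≤n = cancellable-poch-Q N (begin
        E₅ * (E₅ * coef n j)
          ≈⟨ solve 2 (λ e c → e :* (e :* c) := c :* (e :* e)) refl E₅ (coef n j) ⟩
        coef n j * (E₅ * E₅)
          ≈⟨ *-congˡ (*-cong (poch-stable Q Q^N≈0 N≤n+j) (poch-stable Q Q^N≈0 N≤n∸j)) ⟨
        coef n j * (poch Q 0 (n ℕ.+ j) * poch Q 0 (n ℕ.∸ j))
          ≈⟨ coef-closed n (n ℕ.∸ j) j (n ℕ.+ j) (ℕ.m∸n+n≡m (ℕ.m+n≤o⇒m≤o j j+N≤n)) ≡.refl ⟩
        poch Q 0 (n ℕ.+ n)
          ≈⟨ poch-stable Q Q^N≈0 (ℕ.≤-trans N≤n (ℕ.m≤m+n n n)) ⟩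
        E₅
          ≈⟨ *-identityʳ E₅ ⟨
        E₅ * 1# ∎)
        where
        N≤n : N ≤ n
        N≤n = ℕ.m+n≤o⇒n≤o j j+N≤n
        N≤n+j : N ≤ n ℕ.+ j
        N≤n+j = ℕ.≤-trans N≤n (ℕ.m≤m+n n j)
        N≤n∸j : N ≤ n ℕ.∸ j
        N≤n∸j = ≡.subst (_≤ n ℕ.∸ j) (ℕ.m+n∸m≡n j N) (ℕ.∸-monoˡ-≤ j j+N≤n)

      θ-divisible : ∀ x j → ∃[ r ] θ x j ≈ x ^ j * r
      θ-divisible x zero    = 1# , sym (*-identityˡ 1#)
      θ-divisible x (suc j) with r , θ≈ ← θ-divisible x j = _ ,
        trans (-‿cong (*-congʳ (*-congʳ θ≈)))
          (solve 4 (λ x y r z → :- (y :* r :* z :* x) := x :* y :* :- (r :* z)) refl x (x ^ j) r (Q ^ j))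

      θ-vanishes : ∀ x j → x ^ j ≈ 0# → θ x j ≈ 0#
      θ-vanishes x j xʲ≈0 with r , θ≈ ← θ-divisible x j =
        trans θ≈ (trans (*-congʳ xʲ≈0) (zeroˡ r))

      θ-q-vanishes : ∀ {j} → N ≤ j → θ q j ≈ 0#
      θ-q-vanishes {j} N≤j = θ-vanishes q j (q^-vanishes N≤j)

      θ-q⁴-vanishes : ∀ {j} → N ≤ j → θ (q ^ 4) j ≈ 0#
      θ-q⁴-vanishes {j} N≤j = θ-vanishes (q ^ 4) j
        (trans (^-assocʳ q 4 j) (q^-vanishes (ℕ.≤-trans N≤j (ℕ.m≤n*m j 4))))

      θ-q-Q : ∀ n → θ q n * Q ^ n ≈ θ (q ^ 4) n * (q ^ n) ^ 2
      θ-q-Q zero    = solve 0 (:1 :* :1 := :1 :* (:1 :* (:1 :* :1))) refl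
      θ-q-Q (suc n) = begin
        - (θ q n * Q ^ n * q) * (Q * Q ^ n)
          ≈⟨ *-congʳ (-‿cong (*-congʳ (θ-q-Q n))) ⟩
        - (θ (q ^ 4) n * (q ^ n) ^ 2 * q) * (Q * Q ^ n)
          ≈⟨ solve 4 (λ t y q z →
               :- (t :* (y :* (y :* :1)) :* q) :* (q :* (q :* (q :* (q :* (q :* :1)))) :* z)
               := :- (t :* z :* (q :* (q :* (q :* (q :* :1))))) :* (q :* y :* (q :* y :* :1)))
               refl (θ (q ^ 4) n) (q ^ n) q (Q ^ n) ⟩
        θ (q ^ 4) (suc n) * (q ^ suc n) ^ 2 ∎

      γ-θ : ∀ n → γ 1# n * q ^ n ≈ θ (q ^ 4) n
      γ-θ zero    = *-identityˡ 1#
      γ-θ (suc n) = begin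
        - (γ 1# n * (1# * 1# * (y ^ 5 * q ^ 3))) * (q * y)
          ≈⟨ solve 4 (λ g y⁵ y q →
               :- (g :* (:1 :* :1 :* (y⁵ :* (q :* (q :* (q :* :1)))))) :* (q :* y)
               := :- (g :* y :* y⁵ :* (q :* (q :* (q :* (q :* :1))))))
               refl (γ 1# n) (y ^ 5) y q ⟩
        - (γ 1# n * y * y ^ 5 * q ^ 4)
          ≈⟨ -‿cong (*-congʳ (*-cong (γ-θ n) (sym (Q^n≈q^n^5 n)))) ⟩
        θ (q ^ 4) (suc n) ∎
        where
        y = q ^ n

      -- At t = 0 the Pochhammer factor is empty, and the factor 1 - q²ⁿ⁺¹ yields the exponents
      -- n(5n+3)/2 and (n+1)(5n+2)/2: the terms j = n and j = -n - 1 of the bilateral series of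
      -- (-1)ʲ q^(j(5j+3)/2).
      S₁-θ : ∀ n → S₁ 0 n ≈ θ (q ^ 4) n + θ q (suc n)
      S₁-θ n = begin
        γ 1# n * y * (1# - 1# * (y ^ 2 * q)) * poch q n 0
          ≈⟨ *-congʳ (*-congʳ (γ-θ n)) ⟩
        θ (q ^ 4) n * (1# - 1# * (y ^ 2 * q)) * 1#
          ≈⟨ solve 3 (λ t z q → t :* (:1 :- :1 :* (z :* q)) :* :1 := t :+ :- (t :* z :* q))
               refl _ _ _ ⟩
        θ (q ^ 4) n - θ (q ^ 4) n * y ^ 2 * q
          ≈⟨ +-congˡ (-‿cong (*-congʳ (θ-q-Q n))) ⟨
        θ (q ^ 4) n + θ q (suc n) ∎
        where
        y = q ^ n

      -- Up to index N the coefficients become 1 after multiplication by `E₅`; beyond it both `θ`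
      -- vanish. Regrouping then pairs θ(q⁴) at n with θ(q) at n + 1.
      triple-product-limit : E₅ * triple K ≈ Σ< (suc K) (S₁ 0)
      triple-product-limit = begin
        E₅ * triple K
          ≈⟨ *-congˡ (finite-triple-product {K} {suc K} ℕ.≤-refl) ⟩
        E₅ * (coef K 0 + Σ< (suc K) (λ j → s j * coef K (suc j)))
          ≈⟨ distribˡ _ _ _ ⟩
        E₅ * coef K 0 + E₅ * Σ< (suc K) (λ j → s j * coef K (suc j))
          ≈⟨ +-cong (E₅*coef (ℕ.m≤n+m N N)) (sym (Σ<-*ˡ (suc K) E₅ _)) ⟩
        1# + Σ< (suc K) (λ j → E₅ * (s j * coef K (suc j)))
          ≈⟨ +-congˡ (Σ<-cong (suc K) (λ {j} _ → term j)) ⟩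
        1# + Σ< (suc K) s
          ≈⟨ +-congˡ (Σ<-+ (suc K) _ _) ⟩
        1# + (Σ< (suc K) (λ j → θ q (suc j)) + Σ< (suc K) (λ j → θ (q ^ 4) (suc j)))
          ≈⟨ solve 3 (λ x y z → x :+ (y :+ z) := (x :+ z) :+ y) refl _ _ _ ⟩
        1# + Σ< (suc K) (λ j → θ (q ^ 4) (suc j)) + Σ< (suc K) (λ j → θ q (suc j))
          ≈⟨ +-congʳ (Σ<-suc (suc K) (θ (q ^ 4))) ⟨
        Σ< (suc K) (θ (q ^ 4)) + θ (q ^ 4) (suc K) + Σ< (suc K) (λ j → θ q (suc j))
          ≈⟨ +-congʳ (trans (+-congˡ (θ-q⁴-vanishes (ℕ.m≤n⇒m≤1+n (ℕ.m≤m+n N N)))) (+-identityʳ _)) ⟩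
        Σ< (suc K) (θ (q ^ 4)) + Σ< (suc K) (λ j → θ q (suc j))
          ≈⟨ Σ<-+ (suc K) _ _ ⟨
        Σ< (suc K) (λ n → θ (q ^ 4) n + θ q (suc n))
          ≈⟨ Σ<-cong (suc K) (λ {n} _ → sym (S₁-θ n)) ⟩
        Σ< (suc K) (S₁ 0) ∎
        where
        s : ℕ → Carrier
        s j = θ q (suc j) + θ (q ^ 4) (suc j)
        term : ∀ j → E₅ * (s j * coef K (suc j)) ≈ s j
        term j with suc j ℕ.≤? N
        ... | yes j<N = begin
          E₅ * (s j * coef K (suc j))  ≈⟨ solve 3 (λ e s c → e :* (s :* c) := s :* (e :* c)) refl _ _ _ ⟩
          s j * (E₅ * coef K (suc j))  ≈⟨ *-congˡ (E₅*coef (ℕ.+-monoˡ-≤ N j<N)) ⟩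
          s j * 1#                     ≈⟨ *-identityʳ _ ⟩
          s j                          ∎
        ... | no  j≮N = begin
          E₅ * (s j * coef K (suc j))  ≈⟨ *-congˡ (*-congʳ s≈0) ⟩
          E₅ * (0# * coef K (suc j))   ≈⟨ solve 2 (λ e c → e :* (con (+ 0) :* c) := con (+ 0)) refl _ _ ⟩
          0#                           ≈⟨ s≈0 ⟨
          s j                          ∎
          where
          N≤1+j : N ≤ suc j
          N≤1+j = ℕ.<⇒≤ (ℕ.≰⇒> j≮N)
          s≈0 : s j ≈ 0#
          s≈0 = trans (+-cong (θ-q-vanishes N≤1+j) (θ-q⁴-vanishes N≤1+j)) (+-identityˡ 0#)

    factors≡2,3[mod5] : ℕ → Carrier
    factors≡2,3[mod5] n = Π< n (λ i → (1# - q ^ (2 ℕ.+ i ℕ.* 5)) * (1# - q ^ (3 ℕ.+ i ℕ.* 5)))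

    private
      poch-residues : ∀ n → poch q 0 (n ℕ.* 5) ≈ poch Q 0 n * triple n * factors≡2,3[mod5] n
      poch-residues zero    = solve 0 (:1 := :1 :* :1 :* :1) refl
      poch-residues (suc n) = begin
        poch q 0 (n ℕ.* 5) * e 1 * e 2 * e 3 * e 4 * e 5
          ≈⟨ *-congʳ (*-congʳ (*-congʳ (*-congʳ (*-congʳ (poch-residues n))))) ⟩
        poch Q 0 n * triple n * factors≡2,3[mod5] n * e 1 * e 2 * e 3 * e 4 * e 5
          ≈⟨ solve 8 (λ p t f e₁ e₂ e₃ e₄ e₅ →
               p :* t :* f :* e₁ :* e₂ :* e₃ :* e₄ :* e₅
               := p :* e₅ :* (t :* (e₁ :* e₄)) :* (f :* (e₂ :* e₃)))
               refl _ _ _ (e 1) (e 2) (e 3) (e 4) (e 5) ⟩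
        poch Q 0 n * e 5 * (triple n * (e 1 * e 4)) * factors≡2,3[mod5] (suc n)
          ≈⟨ *-congʳ (*-cong (*-congˡ (e-Q 5)) (*-congˡ
               (*-cong (trans (e-Q 1) (+-congˡ (-‿cong (*-congʳ (*-identityʳ q))))) (e-Q 4)))) ⟩
        poch Q 0 (suc n) * triple (suc n) * factors≡2,3[mod5] (suc n) ∎
        where
        e : ℕ → Carrier
        e k = 1# - q ^ (k ℕ.+ n ℕ.* 5)
        e-Q : ∀ k → e k ≈ 1# - q ^ k * Q ^ n
        e-Q k = +-congˡ (-‿cong (trans (^-homo-* q k (n ℕ.* 5)) (*-congˡ (sym (Q^n≈q^[n*5] n)))))

      cancellable-triple : ∀ n → Cancellable (triple n)
      cancellable-triple n = cancellable-Π n (λ i → cancellable-* (cancellable-1-q* _)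
        (cancellable-resp (+-congˡ (-‿cong (sym (*-assoc q _ _)))) (cancellable-1-q* _)))

    -- The argument m = 2 corresponds to t = 1, and `S₁≈S₂` moves the sum to t = 0, where it is the
    -- theta series. Both sides multiplied by the factors with residues 0, 1, 4 equal that series;
    -- these factors are then cancelled.
    rogers-ramanujan : ∀ f → N ≤ suc f → α f 2 * factors≡2,3[mod5] K ≈ 1#
    rogers-ramanujan f N≤1+f =
      cancellable-* (cancellable-poch-Q K) (cancellable-triple K) (begin
        poch Q 0 K * triple K * (α f 2 * factors≡2,3[mod5] K)
          ≈⟨ solve 3 (λ x y z → x :* (y :* z) := y :* (x :* z)) refl _ _ _ ⟩
        α f 2 * (poch Q 0 K * triple K * factors≡2,3[mod5] K)
          ≈⟨ *-congˡ (poch-residues K) ⟨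
        α f 2 * poch q 0 (K ℕ.* 5)
          ≈⟨ *-congˡ (poch-stable q qᴺ≈0 (ℕ.≤-trans N≤K (ℕ.m≤m*n K 5))) ⟩
        α f 2 * poch q 0 N
          ≈⟨ α-S₂ {K} (ℕ.m≤n⇒m≤1+n N≤K) f 1 (≡.subst (N ≤_) (ℕ.+-comm 1 f) N≤1+f) ⟩
        Σ< (suc K) (S₂ 1)
          ≈⟨ S₁≈S₂ (ℕ.m≤n⇒m≤1+n N≤K) 0 ⟨
        Σ< (suc K) (S₁ 0)
          ≈⟨ triple-product-limit ⟨
        E₅ * triple K
          ≈⟨ *-congʳ (poch-stable Q Q^N≈0 N≤K) ⟨
        poch Q 0 K * triple K
          ≈⟨ *-identityʳ _ ⟨
        poch Q 0 K * triple K * 1# ∎)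
      where
      N≤K : N ≤ K
      N≤K = ℕ.m≤m+n N N

    -- The ladder series behind C and D

    α-stable : ∀ f m → N ≤ f ℕ.+ m → α f m ≈ α (suc f) m
    α-stable zero    m N≤m = begin
      1#                 ≈⟨ solve 0 (:1 := :1 :+ con (+ 0) :* :1) refl ⟩
      1# + 0# * 1#       ≈⟨ +-congˡ (*-congʳ (q^-vanishes N≤m)) ⟨
      1# + q ^ m * 1#    ∎
    α-stable (suc f) m N≤ = +-cong (α-stable f (suc m) N≤′)
      (*-congˡ (α-stable f (suc (suc m)) (ℕ.≤-trans N≤′ (ℕ.+-monoʳ-≤ f (ℕ.n≤1+n _)))))
      where
      N≤′ : N ≤ f ℕ.+ suc m
      N≤′ = ≡.subst (N ≤_) (≡.sym (ℕ.+-suc f m)) N≤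

    private
      α∞ : ℕ → Carrier
      α∞ = α N

      -- Depth N is sufficient for every m, so the recurrence holds at one fixed depth.
      α∞-unfold : ∀ m → α∞ m ≈ α∞ (suc m) + q ^ m * α∞ (suc (suc m))
      α∞-unfold m = α-stable N m (ℕ.m≤m+n N m)

      α-1 : ∀ f {m} → N ≤ m → α f m ≈ 1#
      α-1 zero    N≤m = refl
      α-1 (suc f) {m} N≤m = begin
        α f (suc m) + q ^ m * _    ≈⟨ +-cong (α-1 f (ℕ.m≤n⇒m≤1+n N≤m)) (*-congʳ (q^-vanishes N≤m)) ⟩
        1# + 0# * _                ≈⟨ solve 1 (λ x → :1 :+ con (+ 0) :* x := :1) refl _ ⟩
        1#                         ∎

    private
      r*2≥N : ∀ {r} → N ≤ r → N ≤ r ℕ.* 2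
      r*2≥N {r} N≤r = ℕ.≤-trans N≤r (ℕ.m≤m*n r 2)

    -- ω f r d generates the pairs of index sets (R, S) with R ≥ r and
    -- S ≥ r + d in which the j-th element rⱼ of R forbids rⱼ + d + j − 1 and
    -- rⱼ + d + j in S; r ∈ R has weight v q²ʳ and s ∈ S has weight u q²ˢ.
    module Ladder (u v : Carrier) where
      private
        X : Carrier
        X = q ^ 2

        X^n≈q^[n*2] : ∀ n → X ^ n ≈ q ^ (n ℕ.* 2)
        X^n≈q^[n*2] n = trans (^-assocʳ q 2 n) (reflexive (≡.cong (q ^_) (ℕ.*-comm 2 n)))

        X^-vanishes : ∀ {n} → N ≤ n → X ^ n ≈ 0#
        X^-vanishes {n} N≤n =
          trans (X^n≈q^[n*2] n) (q^-vanishes (r*2≥N N≤n))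

      ω : ℕ → ℕ → ℕ → Carrier
      ω zero    r d = 1#
      ω (suc f) r d = (1# + u * X ^ (r ℕ.+ d)) * ω f (suc r) d + v * X ^ r * ω f (suc r) (suc d)

      -- Induction on the depth. The hypothesis is applied to both series in the unfolding of ω(r,
      -- d), at d and at d + 1; the correction terms then have to be recombined into ω(r+1, d+1),
      -- which is what `A₁≈′` does.
      ω-suc : ∀ f r d → N ≤ f ℕ.+ r →
              ω (suc f) r d ≈ ω (suc f) r (suc d) + u * X ^ (r ℕ.+ d) * ω f (suc r) d
      ω-suc zero r d N≤r = begin
        (1# + u * X ^ (r ℕ.+ d)) * 1# + v * X ^ r * 1#
          ≈⟨ solve 3 (λ u x y → (:1 :+ u :* x) :* :1 :+ y :* :1
               := (:1 :+ u :* con (+ 0)) :* :1 :+ y :* :1 :+ u :* x :* :1) refl u _ _ ⟩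
        (1# + u * 0#) * 1# + v * X ^ r * 1# + u * X ^ (r ℕ.+ d) * 1#
          ≈⟨ +-congʳ (+-congʳ (*-congʳ (+-congˡ (*-congˡ X^≈0)))) ⟨
        (1# + u * X ^ (r ℕ.+ suc d)) * 1# + v * X ^ r * 1# + u * X ^ (r ℕ.+ d) * 1# ∎
        where
        X^≈0 : X ^ (r ℕ.+ suc d) ≈ 0#
        X^≈0 = X^-vanishes (ℕ.≤-trans N≤r (ℕ.m≤m+n r (suc d)))
      ω-suc (suc f) r d N≤ = begin
        (1# + u * p) * A₀ + w * A₁
          ≈⟨ solve 4 (λ u p a₀ y → (:1 :+ u :* p) :* a₀ :+ y := a₀ :+ y :+ u :* p :* a₀)
               refl u p A₀ (w * A₁) ⟩
        A₀ + w * A₁ + u * p * A₀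
          ≈⟨ +-congʳ (+-cong A₀≈ (*-congˡ A₁≈)) ⟩
        (A₁ + u * (X * p) * B₀) + w * (A₂ + u * (X * (X * p)) * B₁) + u * p * A₀
          ≈⟨ +-congʳ (solve 8 (λ u p w X a₁ a₂ b₀ b₁ →
               (a₁ :+ u :* (X :* p) :* b₀) :+ w :* (a₂ :+ u :* (X :* (X :* p)) :* b₁)
               := a₁ :+ u :* (X :* p) :* (b₀ :+ X :* w :* b₁) :+ w :* a₂)
               refl u p w X A₁ A₂ B₀ B₁) ⟩
        (A₁ + u * (X * p) * (B₀ + X * w * B₁) + w * A₂) + u * p * A₀
          ≈⟨ +-congʳ (+-congʳ (+-congˡ (*-congˡ A₁≈′))) ⟨
        (A₁ + u * (X * p) * A₁ + w * A₂) + u * p * A₀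
          ≈⟨ +-congʳ (+-congʳ (solve 3 (λ a u p → a :+ u :* p :* a := (:1 :+ u :* p) :* a)
               refl A₁ u (X * p))) ⟩
        ((1# + u * (X * p)) * A₁ + w * A₂) + u * p * A₀
          ≡⟨ ≡.cong (λ k → ((1# + u * X ^ k) * A₁ + w * A₂) + u * p * A₀) (ℕ.+-suc r d) ⟨
        ω (suc (suc f)) r (suc d) + u * p * A₀ ∎
        where
        p = X ^ (r ℕ.+ d)
        w = v * X ^ r
        A₀ = ω (suc f) (suc r) d
        A₁ = ω (suc f) (suc r) (suc d)
        A₂ = ω (suc f) (suc r) (suc (suc d))
        B₀ = ω f (suc (suc r)) d
        B₁ = ω f (suc (suc r)) (suc d)
        N≤′ : N ≤ f ℕ.+ suc r
        N≤′ = ≡.subst (N ≤_) (≡.sym (ℕ.+-suc f r)) N≤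
        A₀≈ : A₀ ≈ A₁ + u * (X * p) * B₀
        A₀≈ = ω-suc f (suc r) d N≤′
        A₁≈ : A₁ ≈ A₂ + u * (X * (X * p)) * B₁
        A₁≈ = trans (ω-suc f (suc r) (suc d) N≤′)
          (+-congˡ (*-congʳ (*-congˡ (reflexive (≡.cong (X ^_) (≡.cong suc (ℕ.+-suc r d)))))))
        -- The hypothesis and the defining recursion express `A₀` in two ways; both contain
        -- `u * (X * p) * B₀`, which cancels.
        A₁≈′ : A₁ ≈ B₀ + X * w * B₁
        A₁≈′ = begin
          A₁
            ≈⟨ solve 2 (λ a b → a := a :+ b :- b) refl A₁ (u * (X * p) * B₀) ⟩
          A₁ + u * (X * p) * B₀ - u * (X * p) * B₀
            ≈⟨ +-congʳ A₀≈ ⟨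
          A₀ - u * (X * p) * B₀
            ≈⟨ solve 6 (λ e b₀ v X y b₁ →
                 (:1 :+ e) :* b₀ :+ v :* (X :* y) :* b₁ :- e :* b₀ := b₀ :+ X :* (v :* y) :* b₁)
                 refl (u * (X * p)) B₀ v X (X ^ r) B₁ ⟩
          B₀ + X * w * B₁ ∎

      -- At d = 0 the defining recursion and `ω-suc` share the term with `u`; its removal leaves a
      -- recursion that never reaches d = 2. With `ω-0` it determines the series at d = 0 and d = 1.
      ω-1 : ∀ f r → N ≤ f ℕ.+ r → ω (suc f) r 1 ≈ ω f (suc r) 0 + v * X ^ r * ω f (suc r) 1
      ω-1 f r N≤ = begin
        ω (suc f) r 1
          ≈⟨ solve 2 (λ a b → a := a :+ b :- b) refl _ e ⟩
        ω (suc f) r 1 + e - e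
          ≈⟨ +-congʳ (ω-suc f r 0 N≤) ⟨
        ω (suc f) r 0 - e
          ≈⟨ solve 3 (λ x b y → (:1 :+ x) :* b :+ y :- x :* b := b :+ y) refl _ _ _ ⟩
        ω f (suc r) 0 + v * X ^ r * ω f (suc r) 1 ∎
        where
        e = u * X ^ (r ℕ.+ 0) * ω f (suc r) 0

      ω-0 : ∀ f r → N ≤ f ℕ.+ r → ω (suc f) r 0 ≈ ω (suc f) r 1 + u * X ^ r * ω f (suc r) 0
      ω-0 f r N≤ = trans (ω-suc f r 0 N≤)
        (+-congˡ (*-congʳ (*-congˡ (reflexive (≡.cong (X ^_) (ℕ.+-identityʳ r))))))

      ω-base : ∀ r d → N ≤ r → ω 1 r d ≈ 1#
      ω-base r d N≤r = begin
        (1# + u * X ^ (r ℕ.+ d)) * 1# + v * X ^ r * 1#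
          ≈⟨ +-cong (*-congʳ (+-congˡ (*-congˡ (X^-vanishes (ℕ.≤-trans N≤r (ℕ.m≤m+n r d))))))
                    (*-congʳ (*-congˡ (X^-vanishes N≤r))) ⟩
        (1# + u * 0#) * 1# + v * 0# * 1#
          ≈⟨ solve 2 (λ u v → (:1 :+ u :* con (+ 0)) :* :1 :+ v :* con (+ 0) :* :1 := :1) refl u v ⟩
        1# ∎

      ω₁-step : ∀ f r → N ≤ f ℕ.+ r → ω (suc f) r 1 ≈
                ω f (suc r) 0 + v * q ^ (r ℕ.* 2) * ω f (suc r) 1
      ω₁-step f r N≤ = trans (ω-1 f r N≤) (+-congˡ (*-congʳ (*-congˡ (X^n≈q^[n*2] r))))

      ω₀-step : ∀ f r → N ≤ f ℕ.+ r → ω (suc f) r 0 ≈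
                ω (suc f) r 1 + u * q ^ (r ℕ.* 2) * ω f (suc r) 0
      ω₀-step f r N≤ = trans (ω-0 f r N≤) (+-congˡ (*-congʳ (*-congˡ (X^n≈q^[n*2] r))))

    private
      module Odd  = Ladder 1# q
      module Even = Ladder q 1#

      -- For u = 1, v = q the two ladder steps are the recurrence of `α` at 2r and at 2r + 1.
      ω-odd : ∀ f r → N ≤ f ℕ.+ r →
              Odd.ω (suc f) r 0 ≈ α∞ (r ℕ.* 2) × Odd.ω (suc f) r 1 ≈ α∞ (suc (r ℕ.* 2))
      ω-odd zero    r N≤r =
        trans (Odd.ω-base r 0 N≤r) (sym (α-1 N (r*2≥N N≤r))) ,
        trans (Odd.ω-base r 1 N≤r) (sym (α-1 N (ℕ.m≤n⇒m≤1+n (r*2≥N N≤r))))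
      ω-odd (suc f) r N≤
        with ih₀ , ih₁ ← ω-odd f (suc r) (≡.subst (N ≤_) (≡.sym (ℕ.+-suc f r)) N≤) = eq₀ , eq₁
        where
        y = q ^ (r ℕ.* 2)
        eq₁ : Odd.ω (suc (suc f)) r 1 ≈ α∞ (suc (r ℕ.* 2))
        eq₁ = begin
          Odd.ω (suc (suc f)) r 1
            ≈⟨ Odd.ω₁-step (suc f) r N≤ ⟩
          Odd.ω (suc f) (suc r) 0 + q * y * Odd.ω (suc f) (suc r) 1
            ≈⟨ +-cong ih₀ (*-congˡ ih₁) ⟩
          α∞ (suc (suc (r ℕ.* 2))) + q * y * α∞ (suc (suc (suc (r ℕ.* 2))))
            ≈⟨ α∞-unfold (suc (r ℕ.* 2)) ⟨
          α∞ (suc (r ℕ.* 2)) ∎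
        eq₀ : Odd.ω (suc (suc f)) r 0 ≈ α∞ (r ℕ.* 2)
        eq₀ = begin
          Odd.ω (suc (suc f)) r 0
            ≈⟨ Odd.ω₀-step (suc f) r N≤ ⟩
          Odd.ω (suc (suc f)) r 1 + 1# * y * Odd.ω (suc f) (suc r) 0
            ≈⟨ +-cong eq₁ (*-cong (*-identityˡ y) ih₀) ⟩
          α∞ (suc (r ℕ.* 2)) + y * α∞ (suc (suc (r ℕ.* 2)))
            ≈⟨ α∞-unfold (r ℕ.* 2) ⟨
          α∞ (r ℕ.* 2) ∎

      -- With u = q, v = 1 the value at d = 1 is not a single `α`; the formula for it is what
      -- `ω₀-step` forces once the value at d = 0 is α(2r).
      ω-even : ∀ f r → N ≤ f ℕ.+ r →
               Even.ω (suc f) r 0 ≈ α∞ (r ℕ.* 2) ×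
               Even.ω (suc f) r 1 ≈ α∞ (r ℕ.* 2) - q * q ^ (r ℕ.* 2) * α∞ (suc (suc (r ℕ.* 2)))
      ω-even zero    r N≤r =
        trans (Even.ω-base r 0 N≤r) (sym (α-1 N (r*2≥N N≤r))) ,
        (begin
          Even.ω 1 r 1   ≈⟨ Even.ω-base r 1 N≤r ⟩
          1#             ≈⟨ solve 2 (λ q x → :1 := :1 :- q :* con (+ 0) :* x) refl q _ ⟩
          1# - q * 0# * α∞ (suc (suc (r ℕ.* 2)))
            ≈⟨ +-cong (α-1 N (r*2≥N N≤r)) (-‿cong (*-congʳ (*-congˡ (q^-vanishes (r*2≥N N≤r))))) ⟨
          α∞ (r ℕ.* 2) - q * q ^ (r ℕ.* 2) * α∞ (suc (suc (r ℕ.* 2))) ∎)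
      ω-even (suc f) r N≤
        with ih₀ , ih₁ ← ω-even f (suc r) (≡.subst (N ≤_) (≡.sym (ℕ.+-suc f r)) N≤) = eq₀ , eq₁
        where
        y = q ^ (r ℕ.* 2)
        a₀ = α∞ (r ℕ.* 2)
        a₁ = α∞ (suc (r ℕ.* 2))
        a₂ = α∞ (suc (suc (r ℕ.* 2)))
        a₃ = α∞ (suc (suc (suc (r ℕ.* 2))))
        a₄ = α∞ (suc (suc (suc (suc (r ℕ.* 2)))))
        eq₁ : Even.ω (suc (suc f)) r 1 ≈ a₀ - q * y * a₂
        eq₁ = begin
          Even.ω (suc (suc f)) r 1
            ≈⟨ Even.ω₁-step (suc f) r N≤ ⟩
          Even.ω (suc f) (suc r) 0 + 1# * y * Even.ω (suc f) (suc r) 1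
            ≈⟨ +-cong ih₀ (*-congˡ ih₁) ⟩
          a₂ + 1# * y * (a₂ - q * (q * (q * y)) * a₄)
            -- `q * y * a₃` is added and subtracted, to expose the recurrence of `α` at 2r + 1 and
            -- at 2r + 2.
            ≈⟨ solve 5 (λ q y a₂ a₃ a₄ →
                 a₂ :+ :1 :* y :* (a₂ :- q :* (q :* (q :* y)) :* a₄)
                 := a₂ :+ q :* y :* a₃ :+ y :* a₂ :- q :* y :* (a₃ :+ q :* (q :* y) :* a₄))
                 refl q y a₂ a₃ a₄ ⟩
          a₂ + q * y * a₃ + y * a₂ - q * y * (a₃ + q * (q * y) * a₄)
            ≈⟨ +-cong (+-congʳ (α∞-unfold (suc (r ℕ.* 2))))
                      (-‿cong (*-congˡ (α∞-unfold (suc (suc (r ℕ.* 2)))))) ⟨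
          a₁ + y * a₂ - q * y * a₂
            ≈⟨ +-congʳ (α∞-unfold (r ℕ.* 2)) ⟨
          a₀ - q * y * a₂ ∎
        eq₀ : Even.ω (suc (suc f)) r 0 ≈ a₀
        eq₀ = begin
          Even.ω (suc (suc f)) r 0
            ≈⟨ Even.ω₀-step (suc f) r N≤ ⟩
          Even.ω (suc (suc f)) r 1 + q * y * Even.ω (suc f) (suc r) 0
            ≈⟨ +-cong eq₁ (*-congˡ ih₀) ⟩
          a₀ - q * y * a₂ + q * y * a₂
            ≈⟨ solve 2 (λ a e → a :- e :+ e := a) refl a₀ (q * y * a₂) ⟩
          a₀ ∎

    ω-odd≈α : Odd.ω (suc N) 1 0 ≈ α N 2
    ω-odd≈α = proj₁ (ω-odd N 1 (ℕ.m≤m+n N 1))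

    ω-even≈α : Even.ω (suc N) 1 0 ≈ α N 2
    ω-even≈α = proj₁ (ω-even N 1 (ℕ.m≤m+n N 1))

-- Truncated power series

module PowerSeries where
  open import Data.Integer.Base using (_+_; _*_; -_)
  open ≡
  open ≡-Reasoning

  infixl 7 _⊛_
  infixl 6 _⊕_

  -- The Cauchy product read off from f = f(0) + q · (`f ∘ suc`), so that no index is ever
  -- subtracted.
  _⊕_ _⊛_ : (ℕ → ℤ) → (ℕ → ℤ) → ℕ → ℤ
  (f ⊕ g) n       = f n + g n
  (f ⊛ g) zero    = f 0 * g 0
  (f ⊛ g) (suc n) = f 0 * g (suc n) + (f ∘ suc ⊛ g) n

  𝟘 𝟙 : ℕ → ℤ
  𝟘 n       = + 0
  𝟙 zero    = + 1
  𝟙 (suc n) = + 0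

  ⊛-cong : ∀ n {f f′ g g′} → (∀ {i} → i ≤ n → f i ≡ f′ i) → (∀ {i} → i ≤ n → g i ≡ g′ i) →
           (f ⊛ g) n ≡ (f′ ⊛ g′) n
  ⊛-cong zero    f≡ g≡ = cong₂ _*_ (f≡ z≤n) (g≡ z≤n)
  ⊛-cong (suc n) f≡ g≡ = cong₂ _+_ (cong₂ _*_ (f≡ z≤n) (g≡ ℕ.≤-refl))
    (⊛-cong n (f≡ ∘ s≤s) (g≡ ∘ ℕ.m≤n⇒m≤1+n))

  -- The mirror image of the defining recursion, splitting the right factor; comparing the two gives
  -- commutativity.
  ⊛-sucʳ : ∀ f g n → (f ⊛ g) (suc n) ≡ (f ⊛ g ∘ suc) n + f (suc n) * g 0
  ⊛-sucʳ f g zero    = refl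
  ⊛-sucʳ f g (suc n) = trans (cong (_+_ (f 0 * g (suc (suc n)))) (⊛-sucʳ (f ∘ suc) g n))
    (sym (ℤ.+-assoc (f 0 * g (suc (suc n))) _ _))

  ⊛-comm : ∀ f g n → (f ⊛ g) n ≡ (g ⊛ f) n
  ⊛-comm f g zero    = ℤ.*-comm (f 0) (g 0)
  ⊛-comm f g (suc n) = begin
    f 0 * g (suc n) + (f ∘ suc ⊛ g) n   ≡⟨ cong₂ _+_ (ℤ.*-comm (f 0) _) (⊛-comm (f ∘ suc) g n) ⟩
    g (suc n) * f 0 + (g ⊛ f ∘ suc) n   ≡⟨ ℤ.+-comm (g (suc n) * f 0) _ ⟩
    (g ⊛ f ∘ suc) n + g (suc n) * f 0   ≡⟨ ⊛-sucʳ g f n ⟨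
    (g ⊛ f) (suc n)                     ∎

  ⊛-distribʳ : ∀ f g h n → ((f ⊕ g) ⊛ h) n ≡ (f ⊛ h) n + (g ⊛ h) n
  ⊛-distribʳ f g h zero    = ℤ.*-distribʳ-+ (h 0) (f 0) (g 0)
  ⊛-distribʳ f g h (suc n) = trans
    (cong (_+_ ((f 0 + g 0) * h (suc n))) (⊛-distribʳ (f ∘ suc) (g ∘ suc) h n))
    (rearrange (f 0) (g 0) (h (suc n)) _ _)
    where
    rearrange : ∀ a b c x y → (a + b) * c + (x + y) ≡ (a * c + x) + (b * c + y)
    rearrange = ℤ-Solver.solve-∀

  ⊛-scaleˡ : ∀ c f g n → ((λ i → c * f i) ⊛ g) n ≡ c * (f ⊛ g) n
  ⊛-scaleˡ c f g zero    = ℤ.*-assoc c (f 0) (g 0)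
  ⊛-scaleˡ c f g (suc n) = trans
    (cong (_+_ (c * f 0 * g (suc n))) (⊛-scaleˡ c (f ∘ suc) g n))
    (rearrange c (f 0) (g (suc n)) _)
    where
    rearrange : ∀ c a b x → c * a * b + c * x ≡ c * (a * b + x)
    rearrange = ℤ-Solver.solve-∀

  ⊛-assoc : ∀ f g h n → ((f ⊛ g) ⊛ h) n ≡ (f ⊛ (g ⊛ h)) n
  ⊛-assoc f g h zero    = ℤ.*-assoc (f 0) (g 0) (h 0)
  ⊛-assoc f g h (suc n) = begin
    f 0 * g 0 * h (suc n) + (((λ i → f 0 * g (suc i)) ⊕ (f ∘ suc ⊛ g)) ⊛ h) n
      ≡⟨ cong (_+_ (f 0 * g 0 * h (suc n))) (⊛-distribʳ _ (f ∘ suc ⊛ g) h n) ⟩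
    f 0 * g 0 * h (suc n) + (((λ i → f 0 * g (suc i)) ⊛ h) n + ((f ∘ suc ⊛ g) ⊛ h) n)
      ≡⟨ cong (_+_ (f 0 * g 0 * h (suc n)))
           (cong₂ _+_ (⊛-scaleˡ (f 0) (g ∘ suc) h n) (⊛-assoc (f ∘ suc) g h n)) ⟩
    f 0 * g 0 * h (suc n) + (f 0 * (g ∘ suc ⊛ h) n + (f ∘ suc ⊛ (g ⊛ h)) n)
      ≡⟨ rearrange (f 0) (g 0) (h (suc n)) _ _ ⟩
    f 0 * (g 0 * h (suc n) + (g ∘ suc ⊛ h) n) + (f ∘ suc ⊛ (g ⊛ h)) n ∎
    where
    rearrange : ∀ a b c x y → a * b * c + (a * x + y) ≡ a * (b * c + x) + y
    rearrange = ℤ-Solver.solve-∀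

  ⊛-zeroˡ : ∀ f n → (𝟘 ⊛ f) n ≡ + 0
  ⊛-zeroˡ f zero    = refl
  ⊛-zeroˡ f (suc n) = trans (ℤ.+-identityˡ _) (⊛-zeroˡ f n)

  ⊛-identityˡ : ∀ f n → (𝟙 ⊛ f) n ≡ f n
  ⊛-identityˡ f zero    = ℤ.*-identityˡ (f 0)
  ⊛-identityˡ f (suc n) = trans (cong₂ _+_ (ℤ.*-identityˡ (f (suc n))) (⊛-zeroˡ f n)) (ℤ.+-identityʳ _)

  module _ (N : ℕ) where

    infix 4 _≈_
    -- A record rather than a bare function type, so that `f` and `g` can be recovered from the type
    -- of a proof by unification.
    record _≈_ (f g : ℕ → ℤ) : Set where
      constructor agree
      field
        agreement : ∀ {i} → i < N → f i ≡ g i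
    open _≈_ public

    pointwise : ∀ {f g} → (∀ i → f i ≡ g i) → f ≈ g
    pointwise f≡g = agree λ {i} _ → f≡g i

    truncatedSeries : CommutativeRing 0ℓ 0ℓ
    truncatedSeries = record
      { Carrier = ℕ → ℤ
      ; _≈_ = _≈_
      ; _+_ = _⊕_
      ; _*_ = _⊛_
      ; -_  = λ f n → - f n
      ; 0#  = 𝟘
      ; 1#  = 𝟙
      ; isCommutativeRing = record
        { isRing = record
          { +-isAbelianGroup = record
            { isGroup = record
              { isMonoid = record
                { isSemigroup = record
                  { isMagma = record
                    { isEquivalence = record
                      { refl  = agree λ _ → refl
                      ; sym   = λ (agree p) → agree λ i<N → sym (p i<N)
                      ; trans = λ (agree p) (agree q) → agree λ i<N → trans (p i<N) (q i<N)
                      }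
                    ; ∙-cong = λ (agree p) (agree q) → agree λ i<N → cong₂ _+_ (p i<N) (q i<N)
                    }
                  ; assoc = λ f g h → pointwise λ i → ℤ.+-assoc (f i) (g i) (h i)
                  }
                ; identity = (λ f → pointwise λ i → ℤ.+-identityˡ (f i))
                           , (λ f → pointwise λ i → ℤ.+-identityʳ (f i))
                }
              ; inverse = (λ f → pointwise λ i → ℤ.+-inverseˡ (f i))
                        , (λ f → pointwise λ i → ℤ.+-inverseʳ (f i))
              ; ⁻¹-cong = λ (agree p) → agree λ i<N → cong -_ (p i<N)
              }
            ; comm = λ f g → pointwise λ i → ℤ.+-comm (f i) (g i)
            }
          ; *-cong = λ (agree p) (agree q) → agree λ {i} i<N →
              ⊛-cong i (λ j≤i → p (ℕ.≤-<-trans j≤i i<N)) (λ j≤i → q (ℕ.≤-<-trans j≤i i<N))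
          ; *-assoc = λ f g h → pointwise (⊛-assoc f g h)
          ; *-identity = (λ f → pointwise (⊛-identityˡ f))
                       , (λ f → pointwise λ i → trans (⊛-comm f 𝟙 i) (⊛-identityˡ f i))
          ; distrib = (λ f g h → pointwise λ i → trans (⊛-comm f (g ⊕ h) i)
                        (trans (⊛-distribʳ g h f i) (cong₂ _+_ (⊛-comm g f i) (⊛-comm h f i))))
                    , (λ f g h → pointwise (⊛-distribʳ g h f))
          }
        ; *-comm = λ f g → pointwise (⊛-comm f g)
        }
      }

    private
      module R = CommutativeRing truncatedSeries

    q : ℕ → ℤ
    q zero    = + 0
    q (suc n) = 𝟙 n

    open import Algebra.Properties.Semiring.Exp R.semiring using (_^_)

    q^-diagonal : ∀ k → (q ^ k) k ≡ + 1
    q^-diagonal zero    = refl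
    q^-diagonal (suc k) = trans (ℤ.+-identityˡ _) (trans (⊛-identityˡ (q ^ k) k) (q^-diagonal k))

    q^-off-diagonal : ∀ k {i} → k ≢ i → (q ^ k) i ≡ + 0
    q^-off-diagonal zero    {zero}  0≢0 = ⊥-elim (0≢0 refl)
    q^-off-diagonal zero    {suc i} _   = refl
    q^-off-diagonal (suc k) {zero}  _   = refl
    q^-off-diagonal (suc k) {suc i} k≢i = trans (ℤ.+-identityˡ _)
      (trans (⊛-identityˡ (q ^ k) i) (q^-off-diagonal k (k≢i ∘ cong suc)))

    q^N≈0 : q ^ N R.≈ R.0#
    q^N≈0 = agree λ i<N → q^-off-diagonal N (ℕ.<⇒≢ i<N ∘ sym)

-- Generating functions of weighted lists

module GeneratingFunction {c ℓ} (R : CommutativeRing c ℓ) (q : CommutativeRing.Carrier R) where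
  open CommutativeRing R hiding (zero)
  open import Algebra.Properties.Semiring.Exp semiring

  gf : {X : Set} → (X → ℕ) → List X → Carrier
  gf wt []       = 0#
  gf wt (x ∷ xs) = q ^ wt x + gf wt xs

  gf-++ : ∀ {X : Set} (wt : X → ℕ) xs ys → gf wt (xs ++ ys) ≈ gf wt xs + gf wt ys
  gf-++ wt []       ys = sym (+-identityˡ _)
  gf-++ wt (x ∷ xs) ys = trans (+-congˡ (gf-++ wt xs ys)) (sym (+-assoc _ _ _))

  gf-map : ∀ {X Y : Set} {wt : X → ℕ} {wt′ : Y → ℕ} (g : X → Y) k →
           (∀ x → wt′ (g x) ≡ k ℕ.+ wt x) → ∀ xs → gf wt′ (map g xs) ≈ q ^ k * gf wt xs
  gf-map g k eq []       = sym (zeroʳ _)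
  gf-map {wt = wt} g k eq (x ∷ xs) = trans
    (+-cong (trans (^-congʳ q (eq x)) (^-homo-* q k (wt x))) (gf-map g k eq xs))
    (sym (distribˡ _ _ _))

module _ (N : ℕ) where
  open PowerSeries
  open GeneratingFunction (truncatedSeries N) (q N)
  open import Algebra.Properties.Semiring.Exp (CommutativeRing.semiring (truncatedSeries N)) using (_^_)

  -- Truncation lives only in the equality of series; the carrier consists of whole sequences, so
  -- the count is right in every degree.
  gf-coefficient : ∀ {X : Set} (wt : X → ℕ) xs n →
                   gf wt xs n ≡ + length (filter (λ x → wt x ℕ.≟ n) xs)
  gf-coefficient wt []       n = ≡.refl
  gf-coefficient wt (x ∷ xs) n with wt x ℕ.≟ n
  ... | yes wt≡n = ≡.trans
    (≡.cong₂ ℤ._+_ (≡.trans (≡.cong (λ k → (q N ^ k) n) wt≡n) (q^-diagonal N n))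
               (gf-coefficient wt xs n))
    (≡.cong (λ ys → + length ys) (≡.sym (filter-accept (λ x → wt x ℕ.≟ n) wt≡n)))
  ... | no  wt≢n = ≡.trans
    (≡.cong₂ ℤ._+_ (q^-off-diagonal N (wt x) wt≢n) (gf-coefficient wt xs n))
    (≡.trans (ℤ.+-identityˡ _)
      (≡.cong (λ ys → + length ys) (≡.sym (filter-reject (λ x → wt x ℕ.≟ n) wt≢n))))

-- Enumerations of the four families of partitions

unique-map-local : ∀ {X Y : Set} (g : X → Y) {xs} →
  (∀ {x x′} → x ∈ xs → x′ ∈ xs → g x ≡ g x′ → x ≡ x′) → Unique xs → Unique (map g xs)
unique-map-local g inj []         = []
unique-map-local g inj (x∉ ∷ xs!) =
  All.tabulate (λ gx′∈ gx≡ → let x′ , x′∈ , y≡gx′ = ∈-map⁻ g gx′∈ in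
    All.lookup x∉ x′∈ (inj (here ≡.refl) (there x′∈) (≡.trans gx≡ y≡gx′)))
  ∷ unique-map-local g (λ x∈ x′∈ → inj (there x∈) (there x′∈)) xs!

-- Two lists without repetitions and with the same members are permutations of each other.
length-bijection : ∀ {X Y : Set} (g : X → Y) {xs ys} → Unique xs → Unique ys →
  (∀ {x x′} → x ∈ xs → x′ ∈ xs → g x ≡ g x′ → x ≡ x′) →
  (∀ {x} → x ∈ xs → g x ∈ ys) →
  (∀ {y} → y ∈ ys → ∃[ x ] x ∈ xs × y ≡ g x) →
  length xs ≡ length ys
length-bijection g {xs} {ys} xs! ys! inj to from = ≡.trans (≡.sym (length-map g xs))
  (↭-length (∼bag⇒↭ (unique∧set⇒bag (unique-map-local g inj xs!) ys! (mk⇔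
    (λ y∈ → let _ , x∈ , eq = ∈-map⁻ g y∈ in ≡.subst (_∈ ys) (≡.sym eq) (to x∈))
    (λ y∈ → let _ , x∈ , eq = from y∈ in ≡.subst (_∈ map g xs) (≡.sym eq) (∈-map⁺ g x∈))))))

-- The enumeration `ys` may hold objects of any weight, and may be incomplete in other weights: only
-- those of weight `n` are matched with partitions. This allows enumerations cut off merely by
-- recursion depth.
count-bijection : ∀ {P : Pred (List ℕ) 0ℓ} (P? : Decidable P) n
  {Y : Set} (wt : Y → ℕ) {ys : List Y} → Unique ys → (g : List ℕ → Y) →
  (∀ {ps ps′} → ps IsPartitionOf n → P ps → ps′ IsPartitionOf n → P ps′ → g ps ≡ g ps′ → ps ≡ ps′) →
  (∀ {ps} → ps IsPartitionOf n → P ps → g ps ∈ ys × wt (g ps) ≡ n) →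
  (∀ {y} → y ∈ ys → wt y ≡ n → ∃[ ps ] ps IsPartitionOf n × P ps × y ≡ g ps) →
  count P? n ≡ length (filter (λ y → wt y ℕ.≟ n) ys)
count-bijection P? n wt ys! g inj to from = length-bijection g
  (Unique.filter⁺ P? (partitions-unique n)) (Unique.filter⁺ (λ y → wt y ℕ.≟ n) ys!)
  (λ ps∈ ps′∈ → let p , Pp = split ps∈ ; p′ , Pp′ = split ps′∈ in inj p Pp p′ Pp′)
  (λ ps∈ → let p , Pp = split ps∈ ; gp∈ , wt≡ = to p Pp in
    ∈-filter⁺ (λ y → wt y ℕ.≟ n) gp∈ wt≡)
  (λ y∈ → let y∈ys , wt≡ = ∈-filter⁻ (λ y → wt y ℕ.≟ n) y∈ ; ps , p , Pp , eq = from y∈ys wt≡ in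
    ps , ∈-filter⁺ P? (Equivalence.from ∈-partitions⇔ p) Pp , eq)
  where
  split : ∀ {ps} → ps ∈ filter P? (partitions n) → ps IsPartitionOf n × _
  split ps∈ = let ps∈′ , Pp = ∈-filter⁻ P? ps∈ in Equivalence.to ∈-partitions⇔ ps∈′ , Pp

sum-bounds : ∀ ps → All (_≤ sum ps) ps
sum-bounds []       = []
sum-bounds (p ∷ ps) = ℕ.m≤m+n p _ ∷ All.map (λ x≤ → ℕ.≤-trans x≤ (ℕ.m≤n+m _ p)) (sum-bounds ps)

-- Contains every partition with gaps ≥ 2 and parts in [m, m + f), but also some
-- with larger parts.
gapPartitions : ℕ → ℕ → List (List ℕ)
gapPartitions zero    m = [ [] ]
gapPartitions (suc f) m = gapPartitions f (suc m) ++ map (m ∷_) (gapPartitions f (suc (suc m)))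

Gapped : Pred (List ℕ) 0ℓ
Gapped = AllPairs (λ p q → 2 ℕ.+ p ≤ q)

gapPartitions-sound : ∀ f m {ps} → ps ∈ gapPartitions f m → All (m ≤_) ps × Gapped ps
gapPartitions-sound zero    m (here ≡.refl) = [] , []
gapPartitions-sound (suc f) m ps∈ with ∈-++⁻ (gapPartitions f (suc m)) ps∈
... | inj₁ ps∈ˡ = let m<ps , gap = gapPartitions-sound f (suc m) ps∈ˡ in All.map ℕ.<⇒≤ m<ps , gap
... | inj₂ ps∈ʳ with qs , qs∈ , ≡.refl ← ∈-map⁻ (m ∷_) ps∈ʳ =
  let m+2≤ , gap = gapPartitions-sound f (suc (suc m)) qs∈ in
  ℕ.≤-refl ∷ All.map (ℕ.≤-trans (ℕ.m≤n+m m 2)) m+2≤ , m+2≤ ∷ gap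

<-+-suc : ∀ m {f x} → x < m ℕ.+ suc f → x < suc m ℕ.+ f
<-+-suc m {f} {x} = ≡.subst (x <_) (ℕ.+-suc m f)

gapPartitions-complete : ∀ f m {ps} → All (m ≤_) ps → Gapped ps → All (_< m ℕ.+ f) ps →
                         ps ∈ gapPartitions f m
gapPartitions-complete zero    m {[]}     _ _ _ = here ≡.refl
gapPartitions-complete zero    m {p ∷ ps} (m≤p ∷ _) _ (p<m ∷ _) =
  ⊥-elim (ℕ.≤⇒≯ m≤p (≡.subst (p <_) (ℕ.+-identityʳ m) p<m))
gapPartitions-complete (suc f) m {[]}     _ _ _ = ∈-++⁺ˡ (gapPartitions-complete f (suc m) [] [] [])
gapPartitions-complete (suc f) m {p ∷ ps} (m≤p ∷ _) (p+2≤ ∷ gap) p<@(_ ∷ ps<) with m ℕ.≟ p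
... | yes ≡.refl = ∈-++⁺ʳ _ (∈-map⁺ (m ∷_) (gapPartitions-complete f (suc (suc m)) p+2≤ gap
  (All.map (ℕ.m<n⇒m<1+n ∘ <-+-suc m) ps<)))
... | no  m≢p    = ∈-++⁺ˡ (gapPartitions-complete f (suc m)
  (m<p ∷ All.map (λ p+2≤x → ℕ.≤-trans m<p (ℕ.≤-trans (ℕ.m≤n+m p 2) p+2≤x)) p+2≤) (p+2≤ ∷ gap)
  (All.map (<-+-suc m) p<))
  where
  m<p = ℕ.≤∧≢⇒< m≤p m≢p

gapPartitions-unique : ∀ f m → Unique (gapPartitions f m)
gapPartitions-unique zero    m = [] ∷ []
gapPartitions-unique (suc f) m = Unique.++⁺ (gapPartitions-unique f (suc m))
  (Unique.map⁺ ∷-injectiveʳ (gapPartitions-unique f (suc (suc m)))) disjoint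
  where
  disjoint : ∀ {ps} → ps ∈ gapPartitions f (suc m) ×
                      ps ∈ map (m ∷_) (gapPartitions f (suc (suc m))) → _
  disjoint (ps∈ˡ , ps∈ʳ) with _ , _ , ≡.refl ← ∈-map⁻ (m ∷_) ps∈ʳ =
    ℕ.<-irrefl ≡.refl (All.head (proj₁ (gapPartitions-sound f (suc m) ps∈ˡ)))

noOnes⇒2≤ : ∀ {ps} → All (1 ≤_) ps → NoOnes ps → All (2 ≤_) ps
noOnes⇒2≤ pos 1∉ = All.tabulate λ p∈ → ℕ.≤∧≢⇒< (All.lookup pos p∈) (λ { ≡.refl → 1∉ p∈ })

2≤⇒noOnes : ∀ {ps} → All (2 ≤_) ps → NoOnes ps
2≤⇒noOnes 2≤ps 1∈ = ℕ.<-irrefl ≡.refl (All.lookup 2≤ps 1∈)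

-- No part exceeds n, hence all lie in [2, 2 + f), the range in which the enumeration is complete.
A-gapPartitions : ∀ n f → n ≤ suc f →
  A n ≡ length (filter (λ ps → sum ps ℕ.≟ n) (gapPartitions f 2))
A-gapPartitions n f n≤1+f = count-bijection _ n sum (gapPartitions-unique f 2) id
  (λ _ _ _ _ eq → eq) to from
  where
  to : ∀ {ps} → ps IsPartitionOf n → Distinct ps × NoOnes ps × Gap≥2 ps →
       ps ∈ gapPartitions f 2 × sum ps ≡ n
  to {ps} (mkPartition pos asc total) (_ , 1∉ , gap) =
    gapPartitions-complete f 2 (noOnes⇒2≤ pos 1∉)
      (Linked.Linked⇒AllPairs
        (λ {p} {q} p+2≤q q+2≤r → ℕ.≤-trans p+2≤q (ℕ.≤-trans (ℕ.m≤n+m q 2) q+2≤r))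
        (Linked.zipWith (λ {p} {q} (p≤q , 2≤) → gap⇒ p≤q 2≤) (asc , gap)))
      (All.map (λ p≤ → s≤s (ℕ.≤-trans p≤ (≡.subst (_≤ suc f) (≡.sym total) n≤1+f))) (sum-bounds ps))
    , total
    where
    gap⇒ : ∀ {p q} → p ≤ q → 2 ≤ ∣ p - q ∣ → 2 ℕ.+ p ≤ q
    gap⇒ {p} {q} p≤q 2≤ = ℕ.m≤o∸n⇒m+n≤o 2 p≤q (≡.subst (2 ≤_) (ℕ.m≤n⇒∣m-n∣≡n∸m p≤q) 2≤)
  from : ∀ {ps} → ps ∈ gapPartitions f 2 → sum ps ≡ n →
         ∃[ qs ] qs IsPartitionOf n × (Distinct qs × NoOnes qs × Gap≥2 qs) × ps ≡ qs
  from {ps} ps∈ total with 2≤ps , gap ← gapPartitions-sound f 2 ps∈ =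
    ps ,
    mkPartition (All.map ℕ.<⇒≤ 2≤ps)
      (Linked.AllPairs⇒Linked (AllPairs.map (λ {p} p+2≤q → ℕ.≤-trans (ℕ.m≤n+m p 2) p+2≤q) gap)) total ,
    (AllPairs.map (λ {p} p+2≤q → ℕ.<⇒≢ (ℕ.≤-trans (ℕ.m≤n+m (suc p) 1) p+2≤q)) gap , 2≤⇒noOnes 2≤ps ,
     Linked.AllPairs⇒Linked (AllPairs.map (λ {p} {q} p+2≤q →
       ≡.subst (2 ≤_) (≡.sym (ℕ.m≤n⇒∣m-n∣≡n∸m (ℕ.≤-trans (ℕ.m≤n+m p 2) p+2≤q)))
         (ℕ.m+n≤o⇒m≤o∸n 2 p+2≤q)) gap)) ,
    ≡.refl

-- The first element of the list may be used at most k times, each later one at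
-- most k₀ times.
partitionsInto : ℕ → List ℕ → ℕ → List (List ℕ)
partitionsInto k₀ []       k       = [ [] ]
partitionsInto k₀ (a ∷ as) zero    = partitionsInto k₀ as k₀
partitionsInto k₀ (a ∷ as) (suc k) =
  partitionsInto k₀ as k₀ ++ map (a ∷_) (partitionsInto k₀ (a ∷ as) k)

partitionsInto-sound : ∀ k₀ {as} k → AllPairs _<_ as → ∀ {ps} → ps ∈ partitionsInto k₀ as k →
                       All (_∈ as) ps × AllPairs _≤_ ps
partitionsInto-sound k₀ k       []          (here ≡.refl) = [] , []
partitionsInto-sound k₀ zero    (_ ∷ as<)   ps∈ =
  let ps⊆ , asc = partitionsInto-sound k₀ k₀ as< ps∈ in All.map there ps⊆ , asc
partitionsInto-sound k₀ {a ∷ as} (suc k) (a< ∷ as<) ps∈ with ∈-++⁻ (partitionsInto k₀ as k₀) ps∈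
... | inj₁ ps∈ˡ = let ps⊆ , asc = partitionsInto-sound k₀ k₀ as< ps∈ˡ in All.map there ps⊆ , asc
... | inj₂ ps∈ʳ with qs , qs∈ , ≡.refl ← ∈-map⁻ (a ∷_) ps∈ʳ =
  let qs⊆ , asc = partitionsInto-sound k₀ k (a< ∷ as<) qs∈ in
  here ≡.refl ∷ qs⊆ ,
  All.map (λ { (here ≡.refl) → ℕ.≤-refl ; (there x∈) → ℕ.<⇒≤ (All.lookup a< x∈) }) qs⊆ ∷ asc

-- Multiplicities are controlled through the total number of parts: a coarser bound, but one
-- inherited by tails and still valid when the allowance is reset to `k₀`.
partitionsInto-complete : ∀ k₀ {as} k → AllPairs _<_ as → ∀ {ps} → All (_∈ as) ps → AllPairs _≤_ ps →
                          length ps ≤ k → k ≤ k₀ → ps ∈ partitionsInto k₀ as k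
partitionsInto-complete k₀ k       []          {[]} _ _ _ _ = here ≡.refl
partitionsInto-complete k₀ k       []          {_ ∷ _} (() ∷ _)
partitionsInto-complete k₀ zero    (_ ∷ as<)   {[]} _ _ _ _ =
  partitionsInto-complete k₀ k₀ as< [] [] z≤n ℕ.≤-refl
partitionsInto-complete k₀ (suc k) (_ ∷ as<)   {[]} _ _ _ _ =
  ∈-++⁺ˡ (partitionsInto-complete k₀ k₀ as< [] [] z≤n ℕ.≤-refl)
partitionsInto-complete k₀ (suc k) (a< ∷ as<) {p ∷ ps} (here ≡.refl ∷ ps⊆) (_ ∷ asc) (s≤s ps≤k) k<k₀ =
  ∈-++⁺ʳ _ (∈-map⁺ _ (partitionsInto-complete k₀ k (a< ∷ as<) ps⊆ asc ps≤k (ℕ.<⇒≤ k<k₀)))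
partitionsInto-complete k₀ (suc k) (a< ∷ as<) {p ∷ ps} (there p∈ ∷ ps⊆) (p≤ ∷ asc) ps≤k k≤k₀ =
  ∈-++⁺ˡ (partitionsInto-complete k₀ k₀ as<
    (p∈ ∷ All.zipWith (λ { (here ≡.refl , p≤a) → ⊥-elim (ℕ.<⇒≱ (All.lookup a< p∈) p≤a)
                         ; (there x∈ , _) → x∈ }) (ps⊆ , p≤))
    (p≤ ∷ asc) (ℕ.≤-trans ps≤k k≤k₀) ℕ.≤-refl)

partitionsInto-unique : ∀ k₀ {as} k → AllPairs _<_ as → Unique (partitionsInto k₀ as k)
partitionsInto-unique k₀ k       []         = [] ∷ []
partitionsInto-unique k₀ zero    (_ ∷ as<)  = partitionsInto-unique k₀ k₀ as<
partitionsInto-unique k₀ {a ∷ as} (suc k) (a< ∷ as<) = Unique.++⁺ (partitionsInto-unique k₀ k₀ as<)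
  (Unique.map⁺ ∷-injectiveʳ (partitionsInto-unique k₀ k (a< ∷ as<))) disjoint
  where
  disjoint : ∀ {ps} → ps ∈ partitionsInto k₀ as k₀ ×
                      ps ∈ map (a ∷_) (partitionsInto k₀ (a ∷ as) k) → _
  disjoint (ps∈ˡ , ps∈ʳ) with _ , _ , ≡.refl ← ∈-map⁻ (a ∷_) ps∈ʳ =
    ℕ.<-irrefl ≡.refl (All.lookup a< (All.head (proj₁ (partitionsInto-sound k₀ k₀ as< ps∈ˡ))))

residues2,3 : ℕ → ℕ → List ℕ
residues2,3 zero    i = []
residues2,3 (suc c) i = 2 ℕ.+ i ℕ.* 5 ∷ 3 ℕ.+ i ℕ.* 5 ∷ residues2,3 c (suc i)

residues2,3-> : ∀ c i → All (i ℕ.* 5 <_) (residues2,3 c i)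
residues2,3-> zero    i = []
residues2,3-> (suc c) i = ℕ.n≤1+n _ ∷ ℕ.m≤n⇒m≤1+n (ℕ.n≤1+n _) ∷
  All.map (ℕ.≤-trans (s≤s (ℕ.m≤n+m _ 5))) (residues2,3-> c (suc i))

residues2,3-ascending : ∀ c i → AllPairs _<_ (residues2,3 c i)
residues2,3-ascending zero    i = []
residues2,3-ascending (suc c) i =
  (ℕ.≤-refl ∷ All.map (ℕ.≤-trans (s≤s (ℕ.m≤n+m _ 3))) later) ∷
  All.map (ℕ.≤-trans (s≤s (ℕ.m≤n+m _ 2))) later ∷
  residues2,3-ascending c (suc i)
  where
  later = residues2,3-> c (suc i)

residues2,3-sound : ∀ c i {x} → x ∈ residues2,3 c i → x % 5 ≡ 2 ⊎ x % 5 ≡ 3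
residues2,3-sound (suc c) i (here ≡.refl)         = inj₁ ([m+kn]%n≡m%n 2 i 5)
residues2,3-sound (suc c) i (there (here ≡.refl)) = inj₂ ([m+kn]%n≡m%n 3 i 5)
residues2,3-sound (suc c) i (there (there x∈))    = residues2,3-sound c (suc i) x∈

residues2,3-complete : ∀ c i j → i ≤ j → j < i ℕ.+ c →
                       2 ℕ.+ j ℕ.* 5 ∈ residues2,3 c i × 3 ℕ.+ j ℕ.* 5 ∈ residues2,3 c i
residues2,3-complete zero    i j i≤j j< = ⊥-elim (ℕ.≤⇒≯ i≤j (≡.subst (j <_) (ℕ.+-identityʳ i) j<))
residues2,3-complete (suc c) i j i≤j j< with i ℕ.≟ j
... | yes ≡.refl = here ≡.refl , there (here ≡.refl)
... | no  i≢j    =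
  let 2∈ , 3∈ = residues2,3-complete c (suc i) j (ℕ.≤∧≢⇒< i≤j i≢j) (<-+-suc i j<) in
  there (there 2∈) , there (there 3∈)

∈-residues2,3 : ∀ c x → x % 5 ≡ 2 ⊎ x % 5 ≡ 3 → x < c → x ∈ residues2,3 c 0
∈-residues2,3 c x x% x<c with x% | residues2,3-complete c 0 (x / 5) z≤n (ℕ.≤-<-trans (m/n≤m x 5) x<c)
... | inj₁ x%≡2 | 2∈ , _ = ≡.subst (_∈ residues2,3 c 0)
  (≡.sym (≡.trans (m≡m%n+[m/n]*n x 5) (≡.cong (ℕ._+ x / 5 ℕ.* 5) x%≡2))) 2∈
... | inj₂ x%≡3 | _ , 3∈ = ≡.subst (_∈ residues2,3 c 0)
  (≡.sym (≡.trans (m≡m%n+[m/n]*n x 5) (≡.cong (ℕ._+ x / 5 ℕ.* 5) x%≡3))) 3∈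

length≤sum : ∀ {ps} → All (1 ≤_) ps → length ps ≤ sum ps
length≤sum []           = z≤n
length≤sum (1≤p ∷ pos) = ℕ.+-mono-≤ 1≤p (length≤sum pos)

B-partitionsInto : ∀ n k c → n ≤ k → n < c →
  B n ≡ length (filter (λ ps → sum ps ℕ.≟ n) (partitionsInto k (residues2,3 c 0) k))
B-partitionsInto n k c n≤k n<c = count-bijection _ n sum
  (partitionsInto-unique k k (residues2,3-ascending c 0)) id (λ _ _ _ _ eq → eq) to from
  where
  to : ∀ {ps} → ps IsPartitionOf n → Parts≡2,3[mod5] ps →
       ps ∈ partitionsInto k (residues2,3 c 0) k × sum ps ≡ n
  to {ps} (mkPartition pos asc total) good =
    partitionsInto-complete k k (residues2,3-ascending c 0)
      (All.zipWith (λ {x} (x% , x≤) →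
        ∈-residues2,3 c x x% (ℕ.≤-<-trans (≡.subst (x ≤_) total x≤) n<c)) (good , sum-bounds ps))
      (Linked.Linked⇒AllPairs ℕ.≤-trans asc)
      (ℕ.≤-trans (length≤sum pos) (≡.subst (_≤ k) (≡.sym total) n≤k)) ℕ.≤-refl
    , total
  from : ∀ {ps} → ps ∈ partitionsInto k (residues2,3 c 0) k → sum ps ≡ n →
         ∃[ qs ] qs IsPartitionOf n × Parts≡2,3[mod5] qs × ps ≡ qs
  from {ps} ps∈ total with ps⊆ , asc ← partitionsInto-sound k k (residues2,3-ascending c 0) ps∈ =
    ps ,
    mkPartition (All.map (λ x∈ → ℕ.<-≤-trans (s≤s z≤n) (All.lookup (residues2,3-> c 0) x∈)) ps⊆)
      (Linked.AllPairs⇒Linked asc) total ,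
    All.map (residues2,3-sound c 0) ps⊆ ,
    ≡.refl

-- Ascending lists and the pairs (R, S)

-- Reduces equality of partitions into distinct parts, and of their odd and even sublists, to a
-- comparison of members.
strictly-ascending-≡ : ∀ {xs ys} → AllPairs _<_ xs → AllPairs _<_ ys →
  (∀ {z} → z ∈ xs → z ∈ ys) → (∀ {z} → z ∈ ys → z ∈ xs) → xs ≡ ys
strictly-ascending-≡ []         []         _ _ = ≡.refl
strictly-ascending-≡ []         (_ ∷ _)    _ ⊇ with () ← ⊇ (here ≡.refl)
strictly-ascending-≡ (_ ∷ _)    []         ⊆ _ with () ← ⊆ (here ≡.refl)
strictly-ascending-≡ (x< ∷ xs<) (y< ∷ ys<) ⊆ ⊇
  with x≡y x< y< (⊆ (here ≡.refl)) (⊇ (here ≡.refl))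
  where
  x≡y : ∀ {x y xs ys} → All (x <_) xs → All (y <_) ys → x ∈ y ∷ ys → y ∈ x ∷ xs → x ≡ y
  x≡y _  _  (here eq)  _          = eq
  x≡y _  _  (there _)  (here eq)  = ≡.sym eq
  x≡y x< y< (there x∈) (there y∈) = ⊥-elim (ℕ.<-asym (All.lookup x< y∈) (All.lookup y< x∈))
... | ≡.refl = ≡.cong (_ ∷_) (strictly-ascending-≡ xs< ys< (drop x< ⊆) (drop y< ⊇))
  where
  drop : ∀ {x xs ys} → All (x <_) xs → (∀ {z} → z ∈ x ∷ xs → z ∈ x ∷ ys) → ∀ {z} → z ∈ xs → z ∈ ys
  drop x< ⊆ z∈ with ⊆ (there z∈)
  ... | here ≡.refl = ⊥-elim (ℕ.<-irrefl ≡.refl (All.lookup x< z∈))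
  ... | there z∈′   = z∈′

head-or-above : ∀ {m xs} → All (m ≤_) xs → AllPairs _<_ xs →
  (∃[ ys ] xs ≡ m ∷ ys × All (suc m ≤_) ys × AllPairs _<_ ys) ⊎ All (suc m ≤_) xs
head-or-above []               []         = inj₂ []
head-or-above {m} {x ∷ xs} (m≤x ∷ _) (x< ∷ xs<) with m ℕ.≟ x
... | yes ≡.refl = inj₁ (xs , ≡.refl , x< , xs<)
... | no  m≢x    = inj₂ (m<x ∷ All.map (ℕ.<-trans m<x) x<)
  where
  m<x = ℕ.≤∧≢⇒< m≤x m≢x

-- Started at 0, `d` is j - 1 when the j-th element of R is reached, so the excluded values are rⱼ +
-- j - 1 and rⱼ + j.
Avoids : ℕ → List ℕ → List ℕ → Set
Avoids d []      S = ⊤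
Avoids d (r ∷ R) S = r ℕ.+ d ∉ S × suc (r ℕ.+ d) ∉ S × Avoids (suc d) R S

avoids-∷ : ∀ {s S} d R → All (λ r → s < r ℕ.+ d) R → Avoids d R S → Avoids d R (s ∷ S)
avoids-∷ d []      _          _                 = tt
avoids-∷ {s} d (r ∷ R) (s<r+d ∷ s<) (∉₁ , ∉₂ , av) =
  (λ { (here eq) → ℕ.<⇒≢ s<r+d (≡.sym eq) ; (there r+d∈) → ∉₁ r+d∈ }) ,
  (λ { (here eq) → ℕ.<⇒≢ (ℕ.m<n⇒m<1+n s<r+d) (≡.sym eq) ; (there r+d∈) → ∉₂ r+d∈ }) ,
  avoids-∷ (suc d) R (All.map (λ {x} s< → ℕ.<-≤-trans s< (ℕ.+-monoʳ-≤ x (ℕ.n≤1+n d))) s<) av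

avoids-tail : ∀ {s S} d R → Avoids d R (s ∷ S) → Avoids d R S
avoids-tail d []      _              = tt
avoids-tail d (r ∷ R) (∉₁ , ∉₂ , av) = ∉₁ ∘ there , ∉₂ ∘ there , avoids-tail (suc d) R av

consᴿ consˢ : ℕ → List ℕ × List ℕ → List ℕ × List ℕ
consᴿ r (R , S) = r ∷ R , S
consˢ s (R , S) = R , s ∷ S

-- Taking r into R raises both r and d, so the threshold r + d for S jumps by two; the values
-- skipped, r + d and r + d + 1, are exactly those that r forbids. Otherwise it moves by one, past
-- the single value r + d just decided.
ladder : ℕ → ℕ → ℕ → List (List ℕ × List ℕ)
ladder zero    r d = [ [] , [] ]
ladder (suc f) r d = ladder f (suc r) d
                     ++ map (consˢ (r ℕ.+ d)) (ladder f (suc r) d)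
                     ++ map (consᴿ r) (ladder f (suc r) (suc d))

Admissible : ℕ → ℕ → List ℕ × List ℕ → Set
Admissible r d (R , S) =
  (All (r ≤_) R × AllPairs _<_ R) × (All (r ℕ.+ d ≤_) S × AllPairs _<_ S) × Avoids d R S

ladder-sound : ∀ f r d {c} → c ∈ ladder f r d → Admissible r d c
ladder-sound zero    r d (here ≡.refl) = ([] , []) , ([] , []) , tt
ladder-sound (suc f) r d c∈ with ∈-++⁻ (ladder f (suc r) d) c∈
... | inj₁ c∈₁ =
  let (r<R , R<) , (s<S , S<) , av = ladder-sound f (suc r) d c∈₁ in
  (All.map ℕ.<⇒≤ r<R , R<) , (All.map ℕ.<⇒≤ s<S , S<) , av
... | inj₂ c∈₂₃ with ∈-++⁻ (map (consˢ (r ℕ.+ d)) (ladder f (suc r) d)) c∈₂₃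
... | inj₁ c∈₂ with (R , S) , RS∈ , ≡.refl ← ∈-map⁻ (consˢ (r ℕ.+ d)) c∈₂ =
  let (r<R , R<) , (s<S , S<) , av = ladder-sound f (suc r) d RS∈ in
  (All.map ℕ.<⇒≤ r<R , R<) ,
  (ℕ.≤-refl ∷ All.map ℕ.<⇒≤ s<S , s<S ∷ S<) ,
  avoids-∷ d R (All.map (ℕ.+-monoˡ-< d) r<R) av
... | inj₂ c∈₃ with (R , S) , RS∈ , ≡.refl ← ∈-map⁻ (consᴿ r) c∈₃ =
  let (r<R , R<) , (s≤S , S<) , av = ladder-sound f (suc r) (suc d) RS∈
      r+d+2≤S = All.map (λ {s} → ≡.subst (_≤ s) (≡.cong suc (ℕ.+-suc r d))) s≤S in
  (ℕ.≤-refl ∷ All.map ℕ.<⇒≤ r<R , r<R ∷ R<) ,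
  (All.map (ℕ.≤-trans (ℕ.m≤n+m (r ℕ.+ d) 2)) r+d+2≤S , S<) ,
  (λ r+d∈ → ℕ.<⇒≱ (ℕ.n≤1+n _) (All.lookup r+d+2≤S r+d∈)) ,
  (λ r+d∈ → ℕ.<-irrefl ≡.refl (All.lookup r+d+2≤S r+d∈)) , av

private
  empty : ∀ {m xs} → All (m ≤_) xs → All (_< m ℕ.+ 0) xs → xs ≡ []
  empty             []        []        = ≡.refl
  empty {m} {x ∷ _} (m≤x ∷ _) (x<m ∷ _) = ⊥-elim (ℕ.≤⇒≯ m≤x (≡.subst (x <_) (ℕ.+-identityʳ m) x<m))

ladder-complete : ∀ f r d {R S} → Admissible r d (R , S) →
  All (_< r ℕ.+ f) R → All (_< (r ℕ.+ d) ℕ.+ f) S → (R , S) ∈ ladder f r d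
ladder-complete zero    r d ((r≤R , _) , (s≤S , _) , _) R< S<
  with ≡.refl ← empty r≤R R< | ≡.refl ← empty s≤S S< = here ≡.refl
ladder-complete (suc f) r d {R} {S} ((r≤R , R!) , (s≤S , S!) , av) R< S<
  with head-or-above r≤R R!
... | inj₁ (R′ , ≡.refl , r<R′ , R′!) = let ∉₁ , ∉₂ , av′ = av in
  ∈-++⁺ʳ (ladder f (suc r) d) (∈-++⁺ʳ (map (consˢ (r ℕ.+ d)) (ladder f (suc r) d))
    (∈-map⁺ (consᴿ r) (ladder-complete f (suc r) (suc d)
      ((r<R′ , R′!) ,
       (All.tabulate (λ {s} s∈ → ≡.subst (_≤ s) (≡.sym (≡.cong suc (ℕ.+-suc r d)))
          (ℕ.≤∧≢⇒< (ℕ.≤∧≢⇒< (All.lookup s≤S s∈) (λ { ≡.refl → ∉₁ s∈ })) (λ { ≡.refl → ∉₂ s∈ }))) , S!) ,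
       av′)
      (All.map (<-+-suc r) (All.tail R<))
      (All.map (λ {s} s< → ≡.subst (λ k → s < suc k ℕ.+ f) (≡.sym (ℕ.+-suc r d))
         (ℕ.m<n⇒m<1+n (<-+-suc (r ℕ.+ d) s<))) S<))))
... | inj₂ r<R with head-or-above s≤S S!
... | inj₁ (S′ , ≡.refl , s<S′ , S′!) =
  ∈-++⁺ʳ (ladder f (suc r) d) (∈-++⁺ˡ (∈-map⁺ (consˢ (r ℕ.+ d)) (ladder-complete f (suc r) d
    ((r<R , R!) , (s<S′ , S′!) , avoids-tail d R av)
    (All.map (<-+-suc r) R<) (All.map (<-+-suc (r ℕ.+ d)) (All.tail S<)))))
... | inj₂ s<S =
  ∈-++⁺ˡ (ladder-complete f (suc r) d ((r<R , R!) , (s<S , S!) , av)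
    (All.map (<-+-suc r) R<) (All.map (<-+-suc (r ℕ.+ d)) S<))

ladder-unique : ∀ f r d → Unique (ladder f r d)
ladder-unique zero    r d = [] ∷ []
ladder-unique (suc f) r d = Unique.++⁺ (ladder-unique f (suc r) d)
  (Unique.++⁺
    (Unique.map⁺ (λ eq → ×-≡,≡→≡ (≡.cong proj₁ eq , ∷-injectiveʳ (≡.cong proj₂ eq)))
      (ladder-unique f (suc r) d))
    (Unique.map⁺ (λ eq → ×-≡,≡→≡ (∷-injectiveʳ (≡.cong proj₁ eq) , ≡.cong proj₂ eq))
      (ladder-unique f (suc r) (suc d)))
    disjoint₂₃)
  disjoint₁
  where
  not-above : ∀ {c} → c ∈ ladder f (suc r) d → ∀ {R} → proj₁ c ≡ r ∷ R → ⊥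
  not-above c∈ eq = let (r<R , _) , _ = ladder-sound f (suc r) d c∈ in
    ℕ.<-irrefl ≡.refl (All.head (≡.subst (All _) eq r<R))
  disjoint₂₃ : ∀ {c} → c ∈ map (consˢ (r ℕ.+ d)) (ladder f (suc r) d) ×
                       c ∈ map (consᴿ r) (ladder f (suc r) (suc d)) → _
  disjoint₂₃ (c∈₂ , c∈₃)
    with _ , RS∈ , ≡.refl ← ∈-map⁻ (consˢ (r ℕ.+ d)) c∈₂ with _ , _ , eq ← ∈-map⁻ (consᴿ r) c∈₃ =
    not-above RS∈ (≡.cong proj₁ eq)
  disjoint₁ : ∀ {c} → c ∈ ladder f (suc r) d ×
                      c ∈ map (consˢ (r ℕ.+ d)) (ladder f (suc r) d)
                          ++ map (consᴿ r) (ladder f (suc r) (suc d)) → _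
  disjoint₁ (c∈₁ , c∈₂₃) with ∈-++⁻ (map (consˢ (r ℕ.+ d)) (ladder f (suc r) d)) c∈₂₃
  ... | inj₁ c∈₂ with _ , _ , ≡.refl ← ∈-map⁻ (consˢ (r ℕ.+ d)) c∈₂ =
    let _ , (s<S , _) , _ = ladder-sound f (suc r) d c∈₁ in ℕ.<-irrefl ≡.refl (All.head s<S)
  ... | inj₂ c∈₃ with _ , _ , ≡.refl ← ∈-map⁻ (consᴿ r) c∈₃ = not-above c∈₁ ≡.refl

weight : (φ χ : ℕ → ℕ) → List ℕ × List ℕ → ℕ
weight φ χ (R , S) = sum (map φ R) ℕ.+ sum (map χ S)

-- P is the parity of the parts that forbid others, Q the opposite one; φ and χ
-- recover such parts from their halves.
module ParitySplit
  {P Q : Pred ℕ 0ℓ} (P? : Decidable P) (Q? : Decidable Q)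
  (P⊎Q : ∀ n → P n ⊎ Q n) (P∩Q : ∀ {n} → P n → Q n → ⊥)
  (φ χ : ℕ → ℕ)
  (φ-P : ∀ r → P (φ r)) (χ-Q : ∀ s → Q (χ s))
  (half-φ : ∀ r → ⌊ φ r /2⌋ ≡ r) (half-χ : ∀ s → ⌊ χ s /2⌋ ≡ s)
  (φ-half : ∀ {n} → P n → φ ⌊ n /2⌋ ≡ n) (χ-half : ∀ {n} → Q n → χ ⌊ n /2⌋ ≡ n)
  (g₁ g₂ : ℕ → ℕ → ℕ)
  (g₁-χ : ∀ r d → g₁ (φ r) (suc d) ≡ χ (r ℕ.+ d))
  (g₂-χ : ∀ r d → g₂ (φ r) (suc d) ≡ χ (suc (r ℕ.+ d)))
  where

  -- For d = 0 and the two instances below, this unfolds to `OddCondition` and `EvenCondition`; the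
  -- offset `d` is for the induction along the list of parts.
  Condition : ℕ → List ℕ → List ℕ → Set
  Condition d ps os = (i : Fin (length os)) →
    let o = lookup os i
        j = suc (d ℕ.+ toℕ i)
    in g₁ o j ∉ ps × g₂ o j ∉ ps

  private
    halves : List ℕ → List ℕ
    halves = map ⌊_/2⌋

    ψ : List ℕ → List ℕ × List ℕ
    ψ ps = halves (filter P? ps) , halves (filter Q? ps)

    map-φ-halves : ∀ ps → map φ (halves (filter P? ps)) ≡ filter P? ps
    map-φ-halves ps = ≡.trans (≡.sym (map-∘ (filter P? ps)))
      (map-id-local (All.map φ-half (All.all-filter P? ps)))

    map-χ-halves : ∀ ps → map χ (halves (filter Q? ps)) ≡ filter Q? ps
    map-χ-halves ps = ≡.trans (≡.sym (map-∘ (filter Q? ps)))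
      (map-id-local (All.map χ-half (All.all-filter Q? ps)))

    halves-map-φ : ∀ R → halves (map φ R) ≡ R
    halves-map-φ R = ≡.trans (≡.sym (map-∘ R)) (map-id-local (All.universal half-φ R))

    halves-map-χ : ∀ S → halves (map χ S) ≡ S
    halves-map-χ S = ≡.trans (≡.sym (map-∘ S)) (map-id-local (All.universal half-χ S))

    -- Order properties of `φ` and `χ` at once: all follow from the monotone left inverse `⌊_/2⌋`.
    module _ {f : ℕ → ℕ} (half-f : ∀ r → ⌊ f r /2⌋ ≡ r) where

      f-mono-< : ∀ {r s} → r < s → f r < f s
      f-mono-< {r} {s} r<s = ℕ.≰⇒> λ fs≤fr → ℕ.<⇒≱ r<s
        (≡.subst₂ _≤_ (half-f s) (half-f r) (ℕ.⌊n/2⌋-mono fs≤fr))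

      f-cancel-< : ∀ {r s} → f r < f s → r < s
      f-cancel-< {r} {s} fr<fs = ℕ.≤∧≢⇒<
        (≡.subst₂ _≤_ (half-f r) (half-f s) (ℕ.⌊n/2⌋-mono (ℕ.<⇒≤ fr<fs)))
        (λ { ≡.refl → ℕ.<-irrefl ≡.refl fr<fs })

      2≤f : ∀ {r} → 1 ≤ r → 2 ≤ f r
      2≤f {r} 1≤r = ℕ.≰⇒> λ fr≤1 → ℕ.<⇒≱ 1≤r
        (≡.subst (_≤ 0) (half-f r) (ℕ.⌊n/2⌋-mono fr≤1))

      map-ascending : ∀ {R} → AllPairs _<_ R → AllPairs _<_ (map f R)
      map-ascending = AllPairs.map⁺ ∘ AllPairs.map f-mono-<

      unmap-ascending : ∀ {R} → AllPairs _<_ (map f R) → AllPairs _<_ R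
      unmap-ascending = AllPairs.map f-cancel-< ∘ AllPairs.map⁻

    shift-j : ∀ {ps} {g : ℕ → ℕ → ℕ} {o} d k →
              g o (suc (d ℕ.+ suc k)) ∉ ps → g o (suc (suc d ℕ.+ k)) ∉ ps
    shift-j {ps} {g} {o} d k = ≡.subst (λ j → g o (suc j) ∉ ps) (ℕ.+-suc d k)

    unshift-j : ∀ {ps} {g : ℕ → ℕ → ℕ} {o} d k →
                g o (suc (suc d ℕ.+ k)) ∉ ps → g o (suc (d ℕ.+ suc k)) ∉ ps
    unshift-j {ps} {g} {o} d k = ≡.subst (λ j → g o (suc j) ∉ ps) (≡.sym (ℕ.+-suc d k))

    condition⇒avoids : ∀ {ps S} → (∀ {s} → s ∈ S → χ s ∈ ps) →
      ∀ d R → Condition d ps (map φ R) → Avoids d R S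
    condition⇒avoids S⊆ d []      cond = tt
    condition⇒avoids {ps} S⊆ d (r ∷ R) cond =
      (λ s∈ → proj₁ first (≡.subst (_∈ ps) (≡.sym (g₁-χ r d)) (S⊆ s∈))) ,
      (λ s∈ → proj₂ first (≡.subst (_∈ ps) (≡.sym (g₂-χ r d)) (S⊆ s∈))) ,
      condition⇒avoids S⊆ (suc d) R (λ i → let ∉₁ , ∉₂ = cond (suc i) in
        shift-j {g = g₁} d (toℕ i) ∉₁ , shift-j {g = g₂} d (toℕ i) ∉₂)
      where
      first : g₁ (φ r) (suc d) ∉ ps × g₂ (φ r) (suc d) ∉ ps
      first = ≡.subst (λ k → g₁ (φ r) (suc k) ∉ ps × g₂ (φ r) (suc k) ∉ ps)
        (ℕ.+-identityʳ d) (cond zero)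

    avoids⇒condition : ∀ {ps S} → (∀ {s} → χ s ∈ ps → s ∈ S) →
      ∀ d R → Avoids d R S → Condition d ps (map φ R)
    avoids⇒condition {ps} ⊆S d (r ∷ R) (∉₁ , ∉₂ , av) zero =
      ≡.subst (λ k → g₁ (φ r) (suc k) ∉ ps × g₂ (φ r) (suc k) ∉ ps) (≡.sym (ℕ.+-identityʳ d))
        ( (λ p∈ → ∉₁ (⊆S (≡.subst (_∈ ps) (g₁-χ r d) p∈)))
        , (λ p∈ → ∉₂ (⊆S (≡.subst (_∈ ps) (g₂-χ r d) p∈))))
    avoids⇒condition ⊆S d (r ∷ R) (_ , _ , av) (suc i) =
      let ∉₁ , ∉₂ = avoids⇒condition ⊆S (suc d) R av i in
      unshift-j {g = g₁} d (toℕ i) ∉₁ , unshift-j {g = g₂} d (toℕ i) ∉₂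

    sum-filter : ∀ ps → sum (filter P? ps) ℕ.+ sum (filter Q? ps) ≡ sum ps
    sum-filter []       = ≡.refl
    sum-filter (p ∷ ps) with P⊎Q p
    ... | inj₁ Pp
      rewrite filter-accept P? {xs = ps} Pp | filter-reject Q? {xs = ps} (P∩Q Pp) =
      ≡.trans (ℕ.+-assoc p _ _) (≡.cong (p ℕ.+_) (sum-filter ps))
    ... | inj₂ Qp
      rewrite filter-accept Q? {xs = ps} Qp | filter-reject P? {xs = ps} (λ Pp → P∩Q Pp Qp) = begin
      a ℕ.+ (p ℕ.+ b)   ≡⟨ ℕ.+-assoc a p b ⟨
      a ℕ.+ p ℕ.+ b     ≡⟨ ≡.cong (ℕ._+ b) (ℕ.+-comm a p) ⟩
      p ℕ.+ a ℕ.+ b     ≡⟨ ℕ.+-assoc p a b ⟩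
      p ℕ.+ (a ℕ.+ b)   ≡⟨ ≡.cong (p ℕ.+_) (sum-filter ps) ⟩
      p ℕ.+ sum ps      ∎
      where
      open ≡.≡-Reasoning
      a = sum (filter P? ps)
      b = sum (filter Q? ps)

    wt-ψ : ∀ ps → weight φ χ (ψ ps) ≡ sum ps
    wt-ψ ps = ≡.trans (≡.cong₂ (λ os es → sum os ℕ.+ sum es) (map-φ-halves ps) (map-χ-halves ps))
      (sum-filter ps)

    ascending< : ∀ {n ps} → ps IsPartitionOf n → Distinct ps → AllPairs _<_ ps
    ascending< (mkPartition _ asc _) ps! =
      AllPairs.zipWith (λ (x≤y , x≢y) → ℕ.≤∧≢⇒< x≤y x≢y) (Linked.Linked⇒AllPairs ℕ.≤-trans asc , ps!)

    ψ-injective : ∀ {ps ps′} → AllPairs _<_ ps → AllPairs _<_ ps′ → ψ ps ≡ ψ ps′ → ps ≡ ps′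
    ψ-injective {ps} {ps′} ps< ps′< eq =
      strictly-ascending-≡ ps< ps′< (⊆ eq) (⊆ (≡.sym eq))
      where
      ⊆ : ∀ {ps ps′} → ψ ps ≡ ψ ps′ → ∀ {z} → z ∈ ps → z ∈ ps′
      ⊆ {ps} {ps′} eq {z} z∈ with P⊎Q z
      ... | inj₁ Pz = proj₁ (∈-filter⁻ P? {xs = ps′} (≡.subst (z ∈_)
        (≡.trans (≡.sym (map-φ-halves ps)) (≡.trans (≡.cong (map φ ∘ proj₁) eq) (map-φ-halves ps′)))
        (∈-filter⁺ P? z∈ Pz)))
      ... | inj₂ Qz = proj₁ (∈-filter⁻ Q? {xs = ps′} (≡.subst (z ∈_)
        (≡.trans (≡.sym (map-χ-halves ps)) (≡.trans (≡.cong (map χ ∘ proj₂) eq) (map-χ-halves ps′)))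
        (∈-filter⁺ Q? z∈ Qz)))

    halves-≥1 : ∀ {ps} → All (2 ≤_) ps → All (1 ≤_) (halves ps)
    halves-≥1 = All.map⁺ ∘ All.map ℕ.⌊n/2⌋-mono

    halves-≤ : ∀ {ps b} → All (_≤ b) ps → All (_≤ b) (halves ps)
    halves-≤ = All.map⁺ ∘ All.map (λ {x} x≤b → ℕ.≤-trans (ℕ.⌊n/2⌋≤n x) x≤b)

    χ∈⇒∈halves : ∀ {ps s} → χ s ∈ ps → s ∈ halves (filter Q? ps)
    χ∈⇒∈halves {ps} {s} χs∈ = ≡.subst (_∈ halves (filter Q? ps)) (half-χ s)
      (∈-map⁺ ⌊_/2⌋ (∈-filter⁺ Q? χs∈ (χ-Q s)))

    ∈halves⇒χ∈ : ∀ {ps s} → s ∈ halves (filter Q? ps) → χ s ∈ ps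
    ∈halves⇒χ∈ {ps} {s} s∈ = proj₁ (∈-filter⁻ Q? {xs = ps}
      (≡.subst (χ s ∈_) (map-χ-halves ps) (∈-map⁺ χ s∈)))

    -- The inverse of `ψ`: a pair of index sets is turned back into a partition by sorting the union
    -- of its parts, which is disjoint by parity.
    module Merged {R S} (R! : AllPairs _<_ R) (S! : AllPairs _<_ S) where
      merged : List ℕ
      merged = sort (map φ R ++ map χ S)

      merged-↭ : merged ↭ map φ R ++ map χ S
      merged-↭ = sort-↭ _

      merged-∈ : ∀ {z} → z ∈ merged → z ∈ map φ R ⊎ z ∈ map χ S
      merged-∈ z∈ = ∈-++⁻ (map φ R) (∈-resp-↭ merged-↭ z∈)

      φ∈ : ∀ {z} → z ∈ map φ R → z ∈ merged
      φ∈ z∈ = ∈-resp-↭ (↭-sym merged-↭) (∈-++⁺ˡ z∈)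

      χ∈ : ∀ {z} → z ∈ map χ S → z ∈ merged
      χ∈ z∈ = ∈-resp-↭ (↭-sym merged-↭) (∈-++⁺ʳ (map φ R) z∈)

      map-φ⇒P : ∀ {z} → z ∈ map φ R → P z
      map-φ⇒P z∈ with r , _ , ≡.refl ← ∈-map⁻ φ z∈ = φ-P r

      map-χ⇒Q : ∀ {z} → z ∈ map χ S → Q z
      map-χ⇒Q z∈ with s , _ , ≡.refl ← ∈-map⁻ χ z∈ = χ-Q s

      merged-unique : Unique merged
      merged-unique = Permutation.Unique-resp-↭ (≡.setoid ℕ) (↭⇒↭ₛ (↭-sym merged-↭)) (Unique.++⁺
        (AllPairs.map ℕ.<⇒≢ (map-ascending half-φ R!))
        (AllPairs.map ℕ.<⇒≢ (map-ascending half-χ S!))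
        (λ (z∈φ , z∈χ) → P∩Q (map-φ⇒P z∈φ) (map-χ⇒Q z∈χ)))

      merged< : AllPairs _<_ merged
      merged< = AllPairs.zipWith (λ (x≤y , x≢y) → ℕ.≤∧≢⇒< x≤y x≢y)
        (Linked.Linked⇒AllPairs ℕ.≤-trans (sort-↗ _) , merged-unique)

      filter-P : filter P? merged ≡ map φ R
      filter-P = strictly-ascending-≡ (AllPairs.filter⁺ P? merged<) (map-ascending half-φ R!)
        (λ z∈ → let z∈′ , Pz = ∈-filter⁻ P? {xs = merged} z∈ in
          [ id , (λ z∈χ → ⊥-elim (P∩Q Pz (map-χ⇒Q z∈χ))) ]′ (merged-∈ z∈′))
        (λ z∈ → ∈-filter⁺ P? (φ∈ z∈) (map-φ⇒P z∈))

      filter-Q : filter Q? merged ≡ map χ S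
      filter-Q = strictly-ascending-≡ (AllPairs.filter⁺ Q? merged<) (map-ascending half-χ S!)
        (λ z∈ → let z∈′ , Qz = ∈-filter⁻ Q? {xs = merged} z∈ in
          [ (λ z∈φ → ⊥-elim (P∩Q (map-φ⇒P z∈φ) Qz)) , id ]′ (merged-∈ z∈′))
        (λ z∈ → ∈-filter⁺ Q? (χ∈ z∈) (map-χ⇒Q z∈))

      ψ-merged : (R , S) ≡ ψ merged
      ψ-merged = ×-≡,≡→≡
        ( ≡.sym (≡.trans (≡.cong halves filter-P) (halves-map-φ R))
        , ≡.sym (≡.trans (≡.cong halves filter-Q) (halves-map-χ S)))

  count-ladder : ∀ (cond? : Decidable (λ ps → Condition 0 ps (filter P? ps))) n f → n ≤ f →
    count (λ ps → distinct? ps ×-dec noOnes? ps ×-dec cond? ps) n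
    ≡ length (filter (λ c → weight φ χ c ℕ.≟ n) (ladder f 1 0))
  count-ladder cond? n f n≤f = count-bijection _ n (weight φ χ) (ladder-unique f 1 0) ψ
    (λ p (p! , _) p′ (p′! , _) → ψ-injective (ascending< p p!) (ascending< p′ p′!)) to from
    where
    to : ∀ {ps} → ps IsPartitionOf n → Distinct ps × NoOnes ps × Condition 0 ps (filter P? ps) →
         ψ ps ∈ ladder f 1 0 × weight φ χ (ψ ps) ≡ n
    to {ps} p@(mkPartition pos asc total) (ps! , 1∉ , cond) =
      ladder-complete f 1 0
        ( (halves-≥1 (All.filter⁺ P? 2≤ps) ,
           unmap-ascending half-φ
             (≡.subst (AllPairs _<_) (≡.sym (map-φ-halves ps)) (AllPairs.filter⁺ P? ps<)))
        , (halves-≥1 (All.filter⁺ Q? 2≤ps) ,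
           unmap-ascending half-χ
             (≡.subst (AllPairs _<_) (≡.sym (map-χ-halves ps)) (AllPairs.filter⁺ Q? ps<)))
        , condition⇒avoids ∈halves⇒χ∈ 0 _ (≡.subst (Condition 0 ps) (≡.sym (map-φ-halves ps)) cond))
        (All.map s≤s (halves-≤ (All.filter⁺ P? ps≤f)))
        (All.map s≤s (halves-≤ (All.filter⁺ Q? ps≤f)))
      , ≡.trans (wt-ψ ps) total
      where
      ps< : AllPairs _<_ ps
      ps< = ascending< p ps!
      2≤ps : All (2 ≤_) ps
      2≤ps = noOnes⇒2≤ pos 1∉
      ps≤f : All (_≤ f) ps
      ps≤f = All.map (λ x≤ → ℕ.≤-trans x≤ (≡.subst (_≤ f) (≡.sym total) n≤f)) (sum-bounds ps)
    from : ∀ {c} → c ∈ ladder f 1 0 → weight φ χ c ≡ n → ∃[ ps ] ps IsPartitionOf n ×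
           (Distinct ps × NoOnes ps × Condition 0 ps (filter P? ps)) × c ≡ ψ ps
    from {R , S} c∈ wt≡n with (1≤R , R!) , (1≤S , S!) , av ← ladder-sound f 1 0 c∈ =
      merged ,
      mkPartition (All.map ℕ.<⇒≤ 2≤merged) (sort-↗ _)
        (≡.trans (sum-↭ merged-↭) (≡.trans (sum-++ (map φ R) (map χ S)) wt≡n)) ,
      (merged-unique , 2≤⇒noOnes 2≤merged ,
       ≡.subst (Condition 0 merged) (≡.sym filter-P) (avoids⇒condition
         (λ χs∈ → ≡.subst (_ ∈_) (≡.cong proj₂ (≡.sym ψ-merged)) (χ∈⇒∈halves χs∈)) 0 R av)) ,
      ψ-merged
      where
      open Merged R! S!
      2≤merged : All (2 ≤_) merged
      2≤merged = All.tabulate λ z∈ → [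
        All.lookup (All.map⁺ (All.map (2≤f half-φ) 1≤R)) ,
        All.lookup (All.map⁺ (All.map (2≤f half-χ) 1≤S)) ]′ (merged-∈ z∈)

-- Generating functions of the enumerations

module EnumeratorSeries {c ℓ} (R : CommutativeRing c ℓ) (q : CommutativeRing.Carrier R) where
  open CommutativeRing R hiding (zero)
  open import Algebra.Properties.Semiring.Exp semiring
  open import Relation.Binary.Reasoning.Setoid setoid
  open IntegerSolver R
  open Sums R
  open GeneratingFunction R q
  open RogersRamanujan R q

  gf-gapPartitions : ∀ f m → gf sum (gapPartitions f m) ≈ α f m
  gf-gapPartitions zero    m = +-identityʳ 1#
  gf-gapPartitions (suc f) m = begin
    gf sum (gapPartitions f (suc m) ++ map (m ∷_) (gapPartitions f (suc (suc m))))
      ≈⟨ gf-++ sum (gapPartitions f (suc m)) _ ⟩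
    gf sum (gapPartitions f (suc m)) + gf sum (map (m ∷_) (gapPartitions f (suc (suc m))))
      ≈⟨ +-cong (gf-gapPartitions f (suc m)) (trans
           (gf-map (m ∷_) m (λ _ → ≡.refl) (gapPartitions f (suc (suc m))))
           (*-congˡ (gf-gapPartitions f (suc (suc m))))) ⟩
    α f (suc m) + q ^ m * α f (suc (suc m)) ∎

  eulerFactors : List ℕ → Carrier
  eulerFactors []       = 1#
  eulerFactors (a ∷ as) = (1# - q ^ a) * eulerFactors as

  -- The multiplicity of `a` runs from 0 to `k`: a finite geometric series with its denominator
  -- cleared.
  gf-partitionsInto-∷ : ∀ k₀ a as k →
    gf sum (partitionsInto k₀ (a ∷ as) k) * (1# - q ^ a)
    ≈ (1# - (q ^ a) ^ suc k) * gf sum (partitionsInto k₀ as k₀)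
  gf-partitionsInto-∷ k₀ a as zero    =
    solve 2 (λ g x → g :* (con (+ 1) :- x) := (con (+ 1) :- x :* con (+ 1)) :* g) refl _ (q ^ a)
  gf-partitionsInto-∷ k₀ a as (suc k) = begin
    gf sum (partitionsInto k₀ as k₀ ++ map (a ∷_) (partitionsInto k₀ (a ∷ as) k)) * (1# - x)
      ≈⟨ *-congʳ (gf-++ sum (partitionsInto k₀ as k₀) _) ⟩
    (G + gf sum (map (a ∷_) (partitionsInto k₀ (a ∷ as) k))) * (1# - x)
      ≈⟨ *-congʳ (+-congˡ (gf-map (a ∷_) a (λ _ → ≡.refl) (partitionsInto k₀ (a ∷ as) k))) ⟩
    (G + x * H) * (1# - x)
      ≈⟨ solve 3 (λ g x h → (g :+ x :* h) :* (con (+ 1) :- x)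
           := g :* (con (+ 1) :- x) :+ x :* (h :* (con (+ 1) :- x))) refl G x H ⟩
    G * (1# - x) + x * (H * (1# - x))
      ≈⟨ +-congˡ (*-congˡ (gf-partitionsInto-∷ k₀ a as k)) ⟩
    G * (1# - x) + x * ((1# - x ^ suc k) * G)
      ≈⟨ solve 3 (λ g x y → g :* (con (+ 1) :- x) :+ x :* ((con (+ 1) :- y) :* g)
           := (con (+ 1) :- x :* y) :* g) refl G x (x ^ suc k) ⟩
    (1# - x ^ suc (suc k)) * G ∎
    where
    x = q ^ a
    G = gf sum (partitionsInto k₀ as k₀)
    H = gf sum (partitionsInto k₀ (a ∷ as) k)

  eulerFactors-residues2,3 : ∀ c i → eulerFactors (residues2,3 c i) ≈
    Π< c (λ j → (1# - q ^ (2 ℕ.+ (i ℕ.+ j) ℕ.* 5)) * (1# - q ^ (3 ℕ.+ (i ℕ.+ j) ℕ.* 5)))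
  eulerFactors-residues2,3 zero    i = refl
  eulerFactors-residues2,3 (suc c) i = begin
    (1# - q ^ (2 ℕ.+ i ℕ.* 5)) * ((1# - q ^ (3 ℕ.+ i ℕ.* 5)) * eulerFactors (residues2,3 c (suc i)))
      ≈⟨ *-assoc _ _ _ ⟨
    F i * eulerFactors (residues2,3 c (suc i))
      ≈⟨ *-cong (reflexive (≡.cong F (≡.sym (ℕ.+-identityʳ i)))) (trans
           (eulerFactors-residues2,3 c (suc i))
           (Π<-cong c (λ j → reflexive (≡.cong F (≡.sym (ℕ.+-suc i j)))))) ⟩
    F (i ℕ.+ 0) * Π< c (λ j → F (i ℕ.+ suc j))
      ≈⟨ Π<-suc c (λ j → F (i ℕ.+ j)) ⟨
    Π< (suc c) (λ j → F (i ℕ.+ j)) ∎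
    where
    F : ℕ → Carrier
    F j = (1# - q ^ (2 ℕ.+ j ℕ.* 5)) * (1# - q ^ (3 ℕ.+ j ℕ.* 5))

  module _ (N : ℕ) (qᴺ≈0 : q ^ N ≈ 0#) where
    open Nilpotent N qᴺ≈0

    -- Euler's product. The boundary term of each geometric series is the (N+1)-st power of qᵃ and
    -- vanishes because a ≥ 1, so bounding multiplicities by N costs nothing modulo qᴺ.
    gf-partitionsInto : ∀ {as} → All (1 ≤_) as →
                        gf sum (partitionsInto N as N) * eulerFactors as ≈ 1#
    gf-partitionsInto []                     = trans (*-identityʳ _) (+-identityʳ 1#)
    gf-partitionsInto {a ∷ as} (1≤a ∷ 1≤as) = begin
      gf sum (partitionsInto N (a ∷ as) N) * ((1# - q ^ a) * eulerFactors as)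
        ≈⟨ *-assoc _ _ _ ⟨
      gf sum (partitionsInto N (a ∷ as) N) * (1# - q ^ a) * eulerFactors as
        ≈⟨ *-congʳ (gf-partitionsInto-∷ N a as N) ⟩
      (1# - (q ^ a) ^ suc N) * gf sum (partitionsInto N as N) * eulerFactors as
        ≈⟨ *-congʳ (*-congʳ (+-congˡ (-‿cong (trans (^-assocʳ q a (suc N)) (q^-vanishes
             (ℕ.≤-trans (ℕ.n≤1+n N) (ℕ.m≤n*m (suc N) a {{ℕ.>-nonZero 1≤a}}))))))) ⟩
      (1# - 0#) * gf sum (partitionsInto N as N) * eulerFactors as
        ≈⟨ solve 2 (λ g e → (con (+ 1) :- con (+ 0)) :* g :* e := g :* e) refl _ _ ⟩
      gf sum (partitionsInto N as N) * eulerFactors as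
        ≈⟨ gf-partitionsInto 1≤as ⟩
      1# ∎

    -- Both series are inverse to the same product over the residues 2 and 3, and inverses are
    -- unique.
    gapPartitions≈partitionsInto : gf sum (gapPartitions N 2) ≈
                                   gf sum (partitionsInto N (residues2,3 (N ℕ.+ N) 0) N)
    gapPartitions≈partitionsInto = begin
      gf sum (gapPartitions N 2)  ≈⟨ gf-gapPartitions N 2 ⟩
      a                           ≈⟨ *-identityʳ a ⟨
      a * 1#                      ≈⟨ *-congˡ b*F ⟨
      a * (b * F)                 ≈⟨ solve 3 (λ a b f → a :* (b :* f) := b :* (a :* f)) refl a b F ⟩
      b * (a * F)                 ≈⟨ *-congˡ (rogers-ramanujan N (ℕ.n≤1+n N)) ⟩
      b * 1#                      ≈⟨ *-identityʳ b ⟩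
      b                           ∎
      where
      as = residues2,3 (N ℕ.+ N) 0
      a = α N 2
      b = gf sum (partitionsInto N as N)
      F = factors≡2,3[mod5] (N ℕ.+ N)
      b*F : b * F ≈ 1#
      b*F = trans (*-congˡ (sym (eulerFactors-residues2,3 (N ℕ.+ N) 0)))
        (gf-partitionsInto (All.map (ℕ.≤-trans (s≤s z≤n)) (residues2,3-> (N ℕ.+ N) 0)))

    module _ {φ χ : ℕ → ℕ} {u v : Carrier}
      (q^χ : ∀ s → q ^ χ s ≈ u * (q ^ 2) ^ s) (q^φ : ∀ r → q ^ φ r ≈ v * (q ^ 2) ^ r) where
      open Ladder u v

      gf-ladder : ∀ f r d → gf (weight φ χ) (ladder f r d) ≈ ω f r d
      gf-ladder zero    r d = +-identityʳ 1#
      gf-ladder (suc f) r d = begin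
        gf (weight φ χ) (L ++ map (consˢ (r ℕ.+ d)) L ++ map (consᴿ r) L′)
          ≈⟨ gf-++ (weight φ χ) L _ ⟩
        gf (weight φ χ) L + gf (weight φ χ) (map (consˢ (r ℕ.+ d)) L ++ map (consᴿ r) L′)
          ≈⟨ +-congˡ (gf-++ (weight φ χ) (map (consˢ (r ℕ.+ d)) L) _) ⟩
        gf (weight φ χ) L + (gf (weight φ χ) (map (consˢ (r ℕ.+ d)) L) + gf (weight φ χ) (map (consᴿ r) L′))
          ≈⟨ +-congˡ (+-cong (gf-map (consˢ (r ℕ.+ d)) (χ (r ℕ.+ d)) wt-consˢ L)
                             (gf-map (consᴿ r) (φ r) (λ (R , S) → ℕ.+-assoc (φ r) _ _) L′)) ⟩
        gf (weight φ χ) L + (q ^ χ (r ℕ.+ d) * gf (weight φ χ) L + q ^ φ r * gf (weight φ χ) L′)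
          ≈⟨ +-cong ih (+-cong (*-cong (q^χ (r ℕ.+ d)) ih) (*-cong (q^φ r) (gf-ladder f (suc r) (suc d)))) ⟩
        ω f (suc r) d + (u * (q ^ 2) ^ (r ℕ.+ d) * ω f (suc r) d + v * (q ^ 2) ^ r * ω f (suc r) (suc d))
          ≈⟨ solve 3 (λ x a y → x :+ (a :* x :+ y) := (con (+ 1) :+ a) :* x :+ y) refl _ _ _ ⟩
        ω (suc f) r d ∎
        where
        L = ladder f (suc r) d
        L′ = ladder f (suc r) (suc d)
        ih = gf-ladder f (suc r) d
        wt-consˢ : ∀ c → weight φ χ (consˢ (r ℕ.+ d) c) ≡ χ (r ℕ.+ d) ℕ.+ weight φ χ c
        wt-consˢ (R , S) = ≡.trans (≡.sym (ℕ.+-assoc x y z)) (≡.trans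
          (≡.cong (ℕ._+ z) (ℕ.+-comm x y)) (ℕ.+-assoc y x z))
          where
          x = sum (map φ R)
          y = χ (r ℕ.+ d)
          z = sum (map χ S)

    private
      q^even : ∀ s → q ^ (s ℕ.* 2) ≈ 1# * (q ^ 2) ^ s
      q^even s = begin
        q ^ (s ℕ.* 2)     ≡⟨ ≡.cong (q ^_) (ℕ.*-comm s 2) ⟩
        q ^ (2 ℕ.* s)     ≈⟨ ^-assocʳ q 2 s ⟨
        (q ^ 2) ^ s       ≈⟨ *-identityˡ _ ⟨
        1# * (q ^ 2) ^ s  ∎

      q^odd : ∀ s → q ^ (1 ℕ.+ s ℕ.* 2) ≈ q * (q ^ 2) ^ s
      q^odd s = *-congˡ (trans (q^even s) (*-identityˡ _))

    gapPartitions≈oddLadder : gf sum (gapPartitions N 2) ≈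
      gf (weight (λ r → 1 ℕ.+ r ℕ.* 2) (λ s → s ℕ.* 2)) (ladder (suc N) 1 0)
    gapPartitions≈oddLadder = trans (gf-gapPartitions N 2)
      (sym (trans (gf-ladder q^even q^odd (suc N) 1 0) ω-odd≈α))

    gapPartitions≈evenLadder : gf sum (gapPartitions N 2) ≈
      gf (weight (λ r → r ℕ.* 2) (λ s → 1 ℕ.+ s ℕ.* 2)) (ladder (suc N) 1 0)
    gapPartitions≈evenLadder = trans (gf-gapPartitions N 2)
      (sym (trans (gf-ladder q^odd q^even (suc N) 1 0) ω-even≈α))

-- Halving by parity and the two instances C and D

half-even : ∀ s → ⌊ s ℕ.* 2 /2⌋ ≡ s
half-even zero    = ≡.refl
half-even (suc s) = ≡.cong suc (half-even s)

half-odd : ∀ s → ⌊ 1 ℕ.+ s ℕ.* 2 /2⌋ ≡ s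
half-odd zero    = ≡.refl
half-odd (suc s) = ≡.cong suc (half-odd s)

even⇒half*2 : ∀ {n} → 2 ∣ n → ⌊ n /2⌋ ℕ.* 2 ≡ n
even⇒half*2 (divides-refl k) = ≡.cong (ℕ._* 2) (half-even k)

odd⇒1+half*2 : ∀ {n} → ¬ 2 ∣ n → 1 ℕ.+ ⌊ n /2⌋ ℕ.* 2 ≡ n
odd⇒1+half*2 {zero}        2∤n = ⊥-elim (2∤n (divides 0 ≡.refl))
odd⇒1+half*2 {suc zero}    2∤n = ≡.refl
odd⇒1+half*2 {suc (suc n)} 2∤n = ≡.cong (2 ℕ.+_)
  (odd⇒1+half*2 (λ (divides k n≡) → 2∤n (divides (suc k) (≡.cong (2 ℕ.+_) n≡))))

-- If 2 divided 1 + 2s, doubling its half would give it back; but its half is s.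
odd-is-odd : ∀ s → ¬ 2 ∣ 1 ℕ.+ s ℕ.* 2
odd-is-odd s 2∣ = ℕ.1+n≢n (≡.sym
  (≡.trans (≡.cong (ℕ._* 2) (≡.sym (half-odd s))) (even⇒half*2 2∣)))

C-ladder : ∀ n f → n ≤ f → C n ≡
  length (filter (λ c → weight (λ r → 1 ℕ.+ r ℕ.* 2) (λ s → s ℕ.* 2) c ℕ.≟ n) (ladder f 1 0))
C-ladder = ParitySplit.count-ladder (¬? ∘ (2 ∣?_)) (2 ∣?_)
  (λ n → [ inj₂ , inj₁ ]′ (toSum (2 ∣? n))) (λ 2∤n 2∣n → 2∤n 2∣n)
  _ _ odd-is-odd (λ s → divides s ≡.refl) half-odd half-even odd⇒1+half*2 even⇒half*2
  (λ o j → o ℕ.+ 2 ℕ.* j ℕ.∸ 3) (λ o j → o ℕ.+ 2 ℕ.* j ℕ.∸ 1)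
  (λ r d → ≡.cong (ℕ._∸ 3) (identity r d)) (λ r d → ≡.cong (ℕ._∸ 1) (identity r d))
  oddCondition?
  where
  -- For o = 1 + 2r and j = d + 1. The sum exposes a 3, so the truncated subtractions reduce to the
  -- even numbers with halves r + d and r + d + 1.
  identity : ∀ r d → 1 ℕ.+ r ℕ.* 2 ℕ.+ 2 ℕ.* suc d ≡ 3 ℕ.+ (r ℕ.+ d) ℕ.* 2
  identity = ℕ-Solver.solve-∀

D-ladder : ∀ n f → n ≤ f → D n ≡
  length (filter (λ c → weight (λ r → r ℕ.* 2) (λ s → 1 ℕ.+ s ℕ.* 2) c ℕ.≟ n) (ladder f 1 0))
D-ladder = ParitySplit.count-ladder (2 ∣?_) (¬? ∘ (2 ∣?_))
  (λ n → toSum (2 ∣? n)) (λ 2∣n 2∤n → 2∤n 2∣n)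
  _ _ (λ s → divides s ≡.refl) odd-is-odd half-even half-odd even⇒half*2 odd⇒1+half*2
  (λ e j → e ℕ.+ 2 ℕ.* j ℕ.∸ 1) (λ e j → e ℕ.+ 2 ℕ.* j ℕ.+ 1)
  (λ r d → ≡.cong (ℕ._∸ 1) (identity r d)) identity′
  evenCondition?
  where
  identity : ∀ r d → r ℕ.* 2 ℕ.+ 2 ℕ.* suc d ≡ 2 ℕ.+ (r ℕ.+ d) ℕ.* 2
  identity = ℕ-Solver.solve-∀
  identity′ : ∀ r d → r ℕ.* 2 ℕ.+ 2 ℕ.* suc d ℕ.+ 1 ≡ 1 ℕ.+ suc (r ℕ.+ d) ℕ.* 2
  identity′ = ℕ-Solver.solve-∀

-- Comparison of coefficients

module AtDegree (n : ℕ) where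
  private
    -- The least truncation that still retains the coefficient of qⁿ.
    N = suc n

  open PowerSeries using (truncatedSeries; agreement; q; q^N≈0)
  open GeneratingFunction (truncatedSeries N) (q N)
  open EnumeratorSeries (truncatedSeries N) (q N)

  gf-≈⇒equinumerous : ∀ {X Y : Set} (wtˣ : X → ℕ) (wtʸ : Y → ℕ) xs ys →
    CommutativeRing._≈_ (truncatedSeries N) (gf wtˣ xs) (gf wtʸ ys) →
    length (filter (λ x → wtˣ x ℕ.≟ n) xs) ≡ length (filter (λ y → wtʸ y ℕ.≟ n) ys)
  gf-≈⇒equinumerous wtˣ wtʸ xs ys eq = ℤ.+-injective
    (≡.trans (≡.sym (gf-coefficient N wtˣ xs n))
      (≡.trans (agreement eq ℕ.≤-refl) (gf-coefficient N wtʸ ys n)))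

  A≡B : A n ≡ B n
  A≡B = ≡.trans (A-gapPartitions n N (ℕ.m≤n+m n 2)) (≡.trans
    (gf-≈⇒equinumerous sum sum (gapPartitions N 2) (partitionsInto N (residues2,3 (N ℕ.+ N) 0) N)
      (gapPartitions≈partitionsInto N (q^N≈0 N)))
    (≡.sym (B-partitionsInto n N (N ℕ.+ N) (ℕ.n≤1+n n) (ℕ.m≤m+n N N))))

  A≡C : A n ≡ C n
  A≡C = ≡.trans (A-gapPartitions n N (ℕ.m≤n+m n 2)) (≡.trans
    (gf-≈⇒equinumerous sum (weight _ _) (gapPartitions N 2) (ladder (suc N) 1 0)
      (gapPartitions≈oddLadder N (q^N≈0 N)))
    (≡.sym (C-ladder n (suc N) (ℕ.m≤n+m n 2))))

  A≡D : A n ≡ D n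
  A≡D = ≡.trans (A-gapPartitions n N (ℕ.m≤n+m n 2)) (≡.trans
    (gf-≈⇒equinumerous sum (weight _ _) (gapPartitions N 2) (ladder (suc N) 1 0)
      (gapPartitions≈evenLadder N (q^N≈0 N)))
    (≡.sym (D-ladder n (suc N) (ℕ.m≤n+m n 2))))

theorem5 : (n : ℕ) → 1 ≤ n → A n ≡ B n × B n ≡ C n × C n ≡ D n
theorem5 n _ = A≡B , ≡.trans (≡.sym A≡B) A≡C , ≡.trans (≡.sym A≡C) A≡D
  where open AtDegree n
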